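{- Let $m\ge n\ge 2$ and let $G=(S,T,E_1\cup E_2)$, with $S=[m]$, $T=[n]$, be an augmented bipartite graph with 1-edge set $E_1$ and 2-edge set $E_2$ satisfying conditions (S), (W1), (W2), (W2') and (W3) (all defined in the context). Then the associated doubly simple biquadratic form $$P_G(\mathbf{x},\mathbf{y})=\sum_{(i,j)\in E_1}x_i^2y_j^2+\sum_{(i,j;k,l)\in E_2}(x_iy_j+x_ky_l)^2$$ is irreducible, i.e. $\mathrm{SOS}(P_G)=|E_1|+|E_2|$.
   Context: Notation: $[m]=\{1,\dots,m\}$. An $m\times n$ biquadratic form is a real polynomial $P(\mathbf{x},\mathbf{y})=\sum_{i,k=1}^m\sum_{j,l=1}^n a_{ijkl}x_ix_ky_jy_l$ (with $a_{ijkl}=a_{kjil}=a_{klij}$). It is SOS if $P=\sum_{p=1}^r f_p^2$ with each $f_p$ a real bilinear form in $(\mathbf{x},\mathbf{y})$; the minimum such $r$ is the SOS rank $\mathrm{SOS}(P)$. Augmented bipartite graphs. A cell is a pair $(i,j)\in[m]\times[n]$ ($i$ is its row, $j$ its column). A 1-edge is a cell; $E_1$ is a set of 1-edges, viewed as a bipartite graph $G_1$ on $S=[m]$, $T=[n]$. A 2-edge is an unordered pair of distinct cells, written $(i,j;k,l)$; the cells $(i,j)$ and $(k,l)$ are its two halves. It is nondegenerate if $i\ne k$ and $j\ne l$, row-degenerate if $i=k$ and $j\neq l$, column-degenerate if $i\ne k$ and $j=l$. $E_2$ is a set of 2-edges. A cell is occupied if it is in $E_1$ or is a half of some 2-edge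 in $E_2$; otherwise it is unoccupied. The opposite cells of a nondegenerate 2-edge $(i,j;k,l)$ are $(i,l)$ and $(k,j)$. Two nondegenerate 2-edges of the form $(i,j;k,l)$ and $(i,l;k,j)$ are called complementary. The dependency graph $\mathcal{D}$ is the directed graph whose vertices are the nondegenerate 2-edges in $E_2$, with an arc $e\to e'$ ($e\ne e'$) if both opposite cells of $e$ are occupied and one half of $e'$ is an opposite cell of $e$. Row and column set: an edge's row (column) set is the set of rows (columns) of its cell (1-edge) or of its halves (2-edge). Two edges are vertex-disjoint if their row sets are disjoint and their column sets are disjoint. The opposite cells of a vertex-disjoint pair $e,f$ are the cells formed by a row of one of the two edges and a column of the other. For a 1-edge $(i,j)$ and a 2-edge $(k,l;p,q)$ they are $(i,l),(i,q),(k,j),(p,j)$. Conditions: (S) No 2-edge shares a cell with any 1-edge or with any other 2-edge. (W1) $G_1$ contains no $C_4$ (no two distinct rows have two common columns in $E_1$). (W2) $\mathcal{D}$ contains no directed cycle other than 2-cycles formed by a pair of complementary 2-edges (which are allowed). (W2') There is no nondegenerate 2-edge in $E_2$ whose two opposite cells are both 1-edges. (W3) For every vertex-disjoint pair of edges of $G$ at least one of which is a 2-edge, at least one of the opposite cells of the pair is unoccupied. -}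

module Defs where

open import Algebra.Bundles using (CommutativeRing)
import Algebra.Definitions.RawMonoid as RawMonoidDefinitions
open import Data.Fin.Base using (Fin)
open import Data.List.Base
  using (List; []; _∷_; [_]; _∷ʳ_; _++_; map; foldr; length; cartesianProduct)
import Data.List.Membership.Propositional as Membership
import Data.List.Membership.Setoid as SetoidMembership
open import Data.List.Relation.Binary.Disjoint.Propositional using (Disjoint)
open import Data.List.Relation.Unary.Any using (Any)
open import Data.List.Relation.Unary.Linked using (Linked)
import Data.List.Relation.Unary.Unique.Propositional as Propositional
import Data.List.Relation.Unary.Unique.Setoid as UniqueSetoid
open import Data.Nat.Base as ℕ using (ℕ)
import Data.Nat.Properties as ℕₚ
open import Data.Product.Base using (_×_; _,_; proj₁; proj₂; ∃)
open import Data.Rational.Base as ℚ using (ℚ; 0ℚ; 1ℚ; ½; ∣_∣)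
import Data.Rational.Properties as ℚₚ
open import Data.Sum.Base using (_⊎_; inj₁; inj₂)
open import Data.Vec.Functional using (Vector)
open import Level using (0ℓ)
open import Relation.Binary.Bundles using (Setoid)
open import Relation.Binary.PropositionalEquality
  using (_≡_; _≢_; refl; sym; trans; cong; subst)
open import Relation.Nullary.Decidable.Core using (dec⇒maybe)
open import Relation.Nullary.Negation using (¬_)
open import Tactic.RingSolver using (solve-∀)
open import Tactic.RingSolver.Core.AlmostCommutativeRing
  using (AlmostCommutativeRing; fromCommutativeRing)

Cauchy : (ℕ → ℚ) → Set
Cauchy x = ∀ ε → 0ℚ ℚ.< ε →
  ∃ λ N → ∀ m n → N ℕ.≤ m → N ℕ.≤ n → ∣ x m ℚ.- x n ∣ ℚ.< ε

record ℝ : Set where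
  constructor mkℝ
  field
    seq    : ℕ → ℚ
    cauchy : Cauchy seq

open ℝ public

-- Equality of reals: the sequences differ by a null sequence.

infix 4 _≈_

_≈_ : ℝ → ℝ → Set
x ≈ y = ∀ ε → 0ℚ ℚ.< ε →
  ∃ λ N → ∀ n → N ℕ.≤ n → ∣ seq x n ℚ.- seq y n ∣ ℚ.< ε

private

  ℚ-ring : AlmostCommutativeRing 0ℓ 0ℓ
  ℚ-ring = fromCommutativeRing ℚₚ.+-*-commutativeRing λ q → dec⇒maybe (0ℚ ℚₚ.≟ q)

  negSub : ∀ p q → ℚ.- (p ℚ.- q) ≡ q ℚ.- p
  negSub = solve-∀ ℚ-ring

  subNeg : ∀ a b → b ℚ.- a ≡ ℚ.- a ℚ.- ℚ.- b
  subNeg = solve-∀ ℚ-ring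

  addSub : ∀ p q → p ℚ.+ (q ℚ.- p) ≡ q
  addSub = solve-∀ ℚ-ring

  telescope : ∀ a b c → (a ℚ.- b) ℚ.+ (b ℚ.- c) ≡ a ℚ.- c
  telescope = solve-∀ ℚ-ring

  sumDiff : ∀ a b c d → (a ℚ.- c) ℚ.+ (b ℚ.- d) ≡ (a ℚ.+ b) ℚ.- (c ℚ.+ d)
  sumDiff = solve-∀ ℚ-ring

  productDiff : ∀ a b c d →
    a ℚ.* (b ℚ.- d) ℚ.+ (a ℚ.- c) ℚ.* d ≡ a ℚ.* b ℚ.- c ℚ.* d
  productDiff = solve-∀ ℚ-ring

  ½-positive : ∀ {ε} → 0ℚ ℚ.< ε → 0ℚ ℚ.< ½ ℚ.* ε
  ½-positive {ε} 0<ε = ℚₚ.positive⁻¹ (½ ℚ.* ε)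
    {{ℚₚ.pos*pos⇒pos ½ ε {{ℚ.positive 0<ε}}}}

  halves : ∀ ε → ½ ℚ.* ε ℚ.+ ½ ℚ.* ε ≡ ε
  halves ε = trans (sym (ℚₚ.*-distribʳ-+ ε ½ ½)) (ℚₚ.*-identityˡ ε)

  ∣sum∣<ε : ∀ {a b ε} → ∣ a ∣ ℚ.< ½ ℚ.* ε → ∣ b ∣ ℚ.< ½ ℚ.* ε → ∣ a ℚ.+ b ∣ ℚ.< ε
  ∣sum∣<ε {a} {b} {ε} a< b< = ℚₚ.≤-<-trans (ℚₚ.∣p+q∣≤∣p∣+∣q∣ a b)
    (subst (∣ a ∣ ℚ.+ ∣ b ∣ ℚ.<_) (halves ε) (ℚₚ.+-mono-< a< b<))

  ∣p-q∣≡∣q-p∣ : ∀ p q → ∣ p ℚ.- q ∣ ≡ ∣ q ℚ.- p ∣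
  ∣p-q∣≡∣q-p∣ p q = trans (sym (ℚₚ.∣-p∣≡∣p∣ (p ℚ.- q)))
    (cong ∣_∣ (negSub p q))

  ∣p*q∣< : ∀ {p q r s} → 0ℚ ℚ.< r → ∣ p ∣ ℚ.< r → ∣ q ∣ ℚ.< s → ∣ p ℚ.* q ∣ ℚ.< r ℚ.* s
  ∣p*q∣< {p} {q} {r} {s} 0<r p<r q<s = ℚₚ.≤-<-trans
    (subst (ℚ._≤ r ℚ.* ∣ q ∣) (sym (ℚₚ.∣p*q∣≡∣p∣*∣q∣ p q))
      (ℚₚ.*-monoʳ-≤-nonNeg ∣ q ∣ {{ℚₚ.∣-∣-nonNeg q}} (ℚₚ.<⇒≤ p<r)))
    (ℚₚ.*-monoʳ-<-pos r {{ℚ.positive 0<r}} q<s)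

  +-close : ∀ {a b c d ε} →
    ∣ a ℚ.- c ∣ ℚ.< ½ ℚ.* ε → ∣ b ℚ.- d ∣ ℚ.< ½ ℚ.* ε →
    ∣ (a ℚ.+ b) ℚ.- (c ℚ.+ d) ∣ ℚ.< ε
  +-close {a} {b} {c} {d} {ε} p q = subst (λ z → ∣ z ∣ ℚ.< ε)
    (sumDiff a b c d)
    (∣sum∣<ε p q)

  neg-close : ∀ {a b ε} → ∣ a ℚ.- b ∣ ℚ.< ε → ∣ ℚ.- a ℚ.- ℚ.- b ∣ ℚ.< ε
  neg-close {a} {b} {ε} = subst (ℚ._< ε)
    (trans (∣p-q∣≡∣q-p∣ a b)
      (cong ∣_∣ (subNeg a b)))

  module Scale {ε B : ℚ} (0<ε : 0ℚ ℚ.< ε) (0<B : 0ℚ ℚ.< B) where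
    instance
      B-positive : ℚ.Positive B
      B-positive = ℚ.positive 0<B

      B-nonZero : ℚ.NonZero B
      B-nonZero = ℚₚ.pos⇒nonZero B

    δ : ℚ
    δ = ½ ℚ.* ε ℚ.* ℚ.1/ B

    0<δ : 0ℚ ℚ.< δ
    0<δ = ℚₚ.positive⁻¹ δ {{ℚₚ.pos*pos⇒pos (½ ℚ.* ε)
      {{ℚ.positive (½-positive 0<ε)}} (ℚ.1/ B) {{ℚₚ.1/pos⇒pos B}}}}

    δ*B≡½ε : δ ℚ.* B ≡ ½ ℚ.* ε
    δ*B≡½ε = trans (ℚₚ.*-assoc (½ ℚ.* ε) (ℚ.1/ B) B)
      (trans (cong (½ ℚ.* ε ℚ.*_) (ℚₚ.*-inverseˡ B)) (ℚₚ.*-identityʳ _))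

    *-close : ∀ {a b c d} → ∣ a ∣ ℚ.< B → ∣ d ∣ ℚ.< B →
      ∣ a ℚ.- c ∣ ℚ.< δ → ∣ b ℚ.- d ∣ ℚ.< δ →
      ∣ a ℚ.* b ℚ.- c ℚ.* d ∣ ℚ.< ε
    *-close {a} {b} {c} {d} a<B d<B a-c<δ b-d<δ = subst (λ z → ∣ z ∣ ℚ.< ε)
      (productDiff a b c d)
      (∣sum∣<ε
        (subst (_ ℚ.<_) (trans (ℚₚ.*-comm B δ) δ*B≡½ε) (∣p*q∣< 0<B a<B b-d<δ))
        (subst (_ ℚ.<_) δ*B≡½ε (∣p*q∣< 0<δ a-c<δ d<B)))
  
  0<1 : 0ℚ ℚ.< 1ℚ
  0<1 = ℚₚ.positive⁻¹ 1ℚ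

  bounded : ∀ x → ∃ λ N → ∃ λ B → 0ℚ ℚ.< B × (∀ n → N ℕ.≤ n → ∣ seq x n ∣ ℚ.< B)
  bounded x with cauchy x 1ℚ 0<1
  ... | N , h = N , B , 0<B , λ n N≤n →
    subst (λ z → ∣ z ∣ ℚ.< B) (addSub (seq x N) (seq x n))
      (ℚₚ.≤-<-trans (ℚₚ.∣p+q∣≤∣p∣+∣q∣ (seq x N) (seq x n ℚ.- seq x N))
                    (ℚₚ.+-monoʳ-< ∣ seq x N ∣ (h n N N≤n ℕₚ.≤-refl)))
    where
    B = ∣ seq x N ∣ ℚ.+ 1ℚ
    0<B : 0ℚ ℚ.< B
    0<B = ℚₚ.+-mono-≤-< {0ℚ} {∣ seq x N ∣} {0ℚ} {1ℚ}
      (ℚₚ.nonNegative⁻¹ ∣ seq x N ∣ {{ℚₚ.∣-∣-nonNeg (seq x N)}}) 0<1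

  ≤ˡ : ∀ M N {n} → M ℕ.⊔ N ℕ.≤ n → M ℕ.≤ n
  ≤ˡ M N = ℕₚ.≤-trans (ℕₚ.m≤m⊔n M N)

  ≤ʳ : ∀ M N {n} → M ℕ.⊔ N ℕ.≤ n → N ℕ.≤ n
  ≤ʳ M N = ℕₚ.≤-trans (ℕₚ.m≤n⊔m M N)

  <⊔ˡ : ∀ p a b → p ℚ.< a → p ℚ.< a ℚ.⊔ b
  <⊔ˡ p a b p<a = ℚₚ.<-≤-trans {p} {a} {a ℚ.⊔ b} p<a (ℚₚ.p≤p⊔q a b)

  <⊔ʳ : ∀ p a b → p ℚ.< b → p ℚ.< a ℚ.⊔ b
  <⊔ʳ p a b p<b = ℚₚ.<-≤-trans {p} {b} {a ℚ.⊔ b} p<b (ℚₚ.p≤q⊔p a b)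

  commonBound : ∀ x y → ∃ λ N → ∃ λ B → 0ℚ ℚ.< B ×
    (∀ n → N ℕ.≤ n → ∣ seq x n ∣ ℚ.< B × ∣ seq y n ∣ ℚ.< B)
  commonBound x y =
    let M , A , 0<A , hx = bounded x
        N , B , 0<B , hy = bounded y
    in M ℕ.⊔ N , A ℚ.⊔ B , <⊔ˡ 0ℚ A B 0<A , λ n le →
      <⊔ˡ (∣ seq x n ∣) A B (hx n (≤ˡ M N le)) ,
      <⊔ʳ (∣ seq y n ∣) A B (hy n (≤ʳ M N le))

  pointwise : ∀ {x y} → (∀ n → seq x n ≡ seq y n) → x ≈ y
  pointwise {x} {y} eq ε 0<ε = 0 , λ n _ →
    subst (ℚ._< ε) (sym (cong ∣_∣ (trans (cong (ℚ._- seq y n) (eq n))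
      (ℚₚ.+-inverseʳ (seq y n))))) 0<ε

fromℚ : ℚ → ℝ
fromℚ q = mkℝ (λ _ → q) λ ε 0<ε → 0 , λ _ _ _ _ →
  subst (λ z → ∣ z ∣ ℚ.< ε) (sym (ℚₚ.+-inverseʳ q)) 0<ε

infixl 6 _+_
infixl 7 _*_
infix  8 -_

_+_ : ℝ → ℝ → ℝ
x + y = mkℝ (λ n → seq x n ℚ.+ seq y n) λ ε 0<ε →
  let M , hx = cauchy x (½ ℚ.* ε) (½-positive 0<ε)
      N , hy = cauchy y (½ ℚ.* ε) (½-positive 0<ε)
  in M ℕ.⊔ N , λ m n p q →
    +-close {seq x m} {seq y m}
      (hx m n (≤ˡ M N p) (≤ˡ M N q)) (hy m n (≤ʳ M N p) (≤ʳ M N q))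

-_ : ℝ → ℝ
- x = mkℝ (λ n → ℚ.- seq x n) λ ε 0<ε →
  let N , h = cauchy x ε 0<ε in N , λ m n p q → neg-close {seq x m} (h m n p q)

_*_ : ℝ → ℝ → ℝ
x * y = mkℝ (λ n → seq x n ℚ.* seq y n) λ ε 0<ε →
  let K , B , 0<B , b = commonBound x y
      open Scale 0<ε 0<B
      M , hx = cauchy x δ 0<δ
      N , hy = cauchy y δ 0<δ
  in K ℕ.⊔ (M ℕ.⊔ N) , λ m n p q →
    let p′ = ≤ʳ K (M ℕ.⊔ N) p
        q′ = ≤ʳ K (M ℕ.⊔ N) q
    in *-close {seq x m} {seq y m}
      (proj₁ (b m (≤ˡ K (M ℕ.⊔ N) p))) (proj₂ (b n (≤ˡ K (M ℕ.⊔ N) q)))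
      (hx m n (≤ˡ M N p′) (≤ˡ M N q′)) (hy m n (≤ʳ M N p′) (≤ʳ M N q′))

0ℝ 1ℝ : ℝ
0ℝ = fromℚ 0ℚ
1ℝ = fromℚ 1ℚ

≈-refl : ∀ {x} → x ≈ x
≈-refl {x} = pointwise {x} {x} λ _ → refl

≈-sym : ∀ {x y} → x ≈ y → y ≈ x
≈-sym {x} {y} x≈y ε 0<ε = let N , h = x≈y ε 0<ε in
  N , λ n p → subst (ℚ._< ε) (∣p-q∣≡∣q-p∣ (seq x n) (seq y n)) (h n p)

≈-trans : ∀ {x y z} → x ≈ y → y ≈ z → x ≈ z
≈-trans {x} {y} {z} x≈y y≈z ε 0<ε =
  let M , h = x≈y (½ ℚ.* ε) (½-positive 0<ε)
      N , k = y≈z (½ ℚ.* ε) (½-positive 0<ε)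
  in M ℕ.⊔ N , λ n p → subst (λ w → ∣ w ∣ ℚ.< ε)
    (telescope (seq x n) (seq y n) (seq z n))
    (∣sum∣<ε (h n (≤ˡ M N p)) (k n (≤ʳ M N p)))

+-cong : ∀ {x y u v} → x ≈ y → u ≈ v → x + u ≈ y + v
+-cong {x} {y} {u} {v} x≈y u≈v ε 0<ε =
  let M , h = x≈y (½ ℚ.* ε) (½-positive 0<ε)
      N , k = u≈v (½ ℚ.* ε) (½-positive 0<ε)
  in M ℕ.⊔ N , λ n p → +-close {seq x n} {seq u n}
    (h n (≤ˡ M N p)) (k n (≤ʳ M N p))

-‿cong : ∀ {x y} → x ≈ y → - x ≈ - y
-‿cong {x} x≈y ε 0<ε = let N , h = x≈y ε 0<ε in N , λ n p → neg-close {seq x n} (h n p)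

*-cong : ∀ {x y u v} → x ≈ y → u ≈ v → x * u ≈ y * v
*-cong {x} {y} {u} {v} x≈y u≈v ε 0<ε =
  let K , B , 0<B , b = commonBound x v
      open Scale 0<ε 0<B
      M , h = x≈y δ 0<δ
      N , k = u≈v δ 0<δ
  in K ℕ.⊔ (M ℕ.⊔ N) , λ n p →
    let q = ≤ʳ K (M ℕ.⊔ N) p
        bx , bv = b n (≤ˡ K (M ℕ.⊔ N) p)
    in *-close {seq x n} {seq u n} bx bv
      (h n (≤ˡ M N q)) (k n (≤ʳ M N q))

ℝ-commutativeRing : CommutativeRing 0ℓ 0ℓ
ℝ-commutativeRing = record
  { Carrier = ℝ ; _≈_ = _≈_ ; _+_ = _+_ ; _*_ = _*_ ; -_ = -_ ; 0# = 0ℝ ; 1# = 1ℝ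
  ; isCommutativeRing = record
    { isRing = record
      { +-isAbelianGroup = record
        { isGroup = record
          { isMonoid = record
            { isSemigroup = record
              { isMagma = record
                { isEquivalence = record
                  { refl  = λ {x} → ≈-refl {x}
                  ; sym   = λ {x} {y} → ≈-sym {x} {y}
                  ; trans = λ {x} {y} {z} → ≈-trans {x} {y} {z}
                  }
                ; ∙-cong = λ {x} {y} {u} {v} → +-cong {x} {y} {u} {v}
                }
              ; assoc = λ x y z → pointwise {(x + y) + z} {x + (y + z)}
                  λ n → ℚₚ.+-assoc (seq x n) (seq y n) (seq z n)
              }
            ; identity =
                (λ x → pointwise {0ℝ + x} {x} λ n → ℚₚ.+-identityˡ (seq x n)) ,
                (λ x → pointwise {x + 0ℝ} {x} λ n → ℚₚ.+-identityʳ (seq x n))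
            }
          ; inverse =
              (λ x → pointwise { - x + x} {0ℝ} λ n → ℚₚ.+-inverseˡ (seq x n)) ,
              (λ x → pointwise {x + - x} {0ℝ} λ n → ℚₚ.+-inverseʳ (seq x n))
          ; ⁻¹-cong = λ {x} {y} → -‿cong {x} {y}
          }
        ; comm = λ x y → pointwise {x + y} {y + x} λ n → ℚₚ.+-comm (seq x n) (seq y n)
        }
      ; *-cong = λ {x} {y} {u} {v} → *-cong {x} {y} {u} {v}
      ; *-assoc = λ x y z → pointwise {(x * y) * z} {x * (y * z)}
          λ n → ℚₚ.*-assoc (seq x n) (seq y n) (seq z n)
      ; *-identity =
          (λ x → pointwise {1ℝ * x} {x} λ n → ℚₚ.*-identityˡ (seq x n)) ,
          (λ x → pointwise {x * 1ℝ} {x} λ n → ℚₚ.*-identityʳ (seq x n))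
      ; distrib =
          (λ x y z → pointwise {x * (y + z)} {x * y + x * z}
            λ n → ℚₚ.*-distribˡ-+ (seq x n) (seq y n) (seq z n)) ,
          (λ x y z → pointwise {(y + z) * x} {y * x + z * x}
            λ n → ℚₚ.*-distribʳ-+ (seq x n) (seq y n) (seq z n))
      }
    ; *-comm = λ x y → pointwise {x * y} {y * x} λ n → ℚₚ.*-comm (seq x n) (seq y n)
    }
  }

open RawMonoidDefinitions (CommutativeRing.+-rawMonoid ℝ-commutativeRing) public
  using (sum)

infix 9 _²

_² : ℝ → ℝ
x ² = x * x

-- A real polynomial P(x, y) is determined by the function it defines (ℝ is
-- infinite) and is represented by that function.

Form : ℕ → ℕ → Set
Form m n = Vector ℝ m → Vector ℝ n → ℝ

bilinear : ∀ {m n} → (Fin m → Fin n → ℝ) → Form m n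
bilinear b x y = sum λ i → sum λ j → b i j * x i * y j

IsSumOfSquares : ∀ {m n} → Form m n → ℕ → Set
IsSumOfSquares {m} {n} P r = ∃ λ (b : Fin r → Fin m → Fin n → ℝ) →
  ∀ x y → P x y ≈ sum λ p → bilinear (b p) x y ²

-- SOS(P) = r: r is the least number of squares.

HasSOSRank : ∀ {m n} → Form m n → ℕ → Set
HasSOSRank P r = IsSumOfSquares P r × (∀ s → IsSumOfSquares P s → r ℕ.≤ s)

Cell : ℕ → ℕ → Set
Cell m n = Fin m × Fin n

-- A 2-edge (i,j;k,l) stores its halves in some order; _≋_ identifies the
-- two orders.

record TwoEdge (m n : ℕ) : Set where
  field
    half₁ half₂ : Cell m n
    distinct    : half₁ ≢ half₂

open TwoEdge public

module _ {m n : ℕ} where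

  open Membership {A = Cell m n} public using () renaming (_∈_ to _∈ᶜ_)

  SameCells : (c₁ c₂ d₁ d₂ : Cell m n) → Set
  SameCells c₁ c₂ d₁ d₂ = (c₁ ≡ d₁ × c₂ ≡ d₂) ⊎ (c₁ ≡ d₂ × c₂ ≡ d₁)

  infix 4 _≋_ _≋̸_

  _≋_ _≋̸_ : TwoEdge m n → TwoEdge m n → Set
  e ≋ f = SameCells (half₁ e) (half₂ e) (half₁ f) (half₂ f)
  e ≋̸ f = ¬ e ≋ f

  twoEdgeSetoid : Setoid 0ℓ 0ℓ
  twoEdgeSetoid = record
    { Carrier = TwoEdge m n
    ; _≈_ = _≋_
    ; isEquivalence = record
      { refl = inj₁ (refl , refl)
      ; sym = λ where
          (inj₁ (refl , refl)) → inj₁ (refl , refl)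
          (inj₂ (refl , refl)) → inj₂ (refl , refl)
      ; trans = λ where
          (inj₁ (refl , refl)) q → q
          (inj₂ (refl , refl)) (inj₁ (refl , refl)) → inj₂ (refl , refl)
          (inj₂ (refl , refl)) (inj₂ (refl , refl)) → inj₁ (refl , refl)
      }
    }

  open SetoidMembership twoEdgeSetoid public using () renaming (_∈_ to _∈²_)

  IsHalf : Cell m n → TwoEdge m n → Set
  IsHalf c e = c ≡ half₁ e ⊎ c ≡ half₂ e

  Nondegenerate : TwoEdge m n → Set
  Nondegenerate e =
    proj₁ (half₁ e) ≢ proj₁ (half₂ e) × proj₂ (half₁ e) ≢ proj₂ (half₂ e)

  opposite₁ opposite₂ : TwoEdge m n → Cell m n
  opposite₁ e = proj₁ (half₁ e) , proj₂ (half₂ e)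
  opposite₂ e = proj₁ (half₂ e) , proj₂ (half₁ e)

  Complementary : TwoEdge m n → TwoEdge m n → Set
  Complementary e f = Nondegenerate e × Nondegenerate f ×
    SameCells (half₁ f) (half₂ f) (opposite₁ e) (opposite₂ e)

-- Lists without repetition play the role of finite sets, so that |E₁| and
-- |E₂| are their lengths.

record AugmentedBipartiteGraph (m n : ℕ) : Set where
  field
    E₁        : List (Cell m n)
    E₁-unique : Propositional.Unique E₁
    E₂        : List (TwoEdge m n)
    E₂-unique : UniqueSetoid.Unique twoEdgeSetoid E₂

data Edge (m n : ℕ) : Set where
  one : Cell m n → Edge m n
  two : TwoEdge m n → Edge m n

module _ {m n : ℕ} where

  cells : Edge m n → List (Cell m n)
  cells (one c) = [ c ]
  cells (two e) = half₁ e ∷ half₂ e ∷ []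

  rows : Edge m n → List (Fin m)
  rows e = map proj₁ (cells e)

  columns : Edge m n → List (Fin n)
  columns e = map proj₂ (cells e)

  -- The lists of rows and columns are only ever used as sets; a degenerate
  -- 2-edge repeats its row or column.

  VertexDisjoint : Edge m n → Edge m n → Set
  VertexDisjoint e f = Disjoint (rows e) (rows f) × Disjoint (columns e) (columns f)

  oppositeCells : Edge m n → Edge m n → List (Cell m n)
  oppositeCells e f =
    cartesianProduct (rows e) (columns f) ++ cartesianProduct (rows f) (columns e)

  data IsTwoEdge : Edge m n → Set where
    isTwo : ∀ {e} → IsTwoEdge (two e)

  monomial : Vector ℝ m → Vector ℝ n → Cell m n → ℝ
  monomial x y (i , j) = x i * y j

  oneEdgeSquare : Vector ℝ m → Vector ℝ n → Cell m n → ℝ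
  oneEdgeSquare x y (i , j) = x i ² * y j ²

  twoEdgeSquare : Vector ℝ m → Vector ℝ n → TwoEdge m n → ℝ
  twoEdgeSquare x y e = (monomial x y (half₁ e) + monomial x y (half₂ e)) ²

module _ {m n : ℕ} (G : AugmentedBipartiteGraph m n) where

  open AugmentedBipartiteGraph G

  IsEdge : Edge m n → Set
  IsEdge (one c) = c ∈ᶜ E₁
  IsEdge (two e) = e ∈² E₂

  Occupied Unoccupied : Cell m n → Set
  Occupied c   = c ∈ᶜ E₁ ⊎ ∃ λ e → e ∈² E₂ × IsHalf c e
  Unoccupied c = ¬ Occupied c

  IsVertex : TwoEdge m n → Set
  IsVertex e = e ∈² E₂ × Nondegenerate e

  Arc : TwoEdge m n → TwoEdge m n → Set
  Arc e f = IsVertex e × IsVertex f × e ≋̸ f ×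
    Occupied (opposite₁ e) × Occupied (opposite₂ e) ×
    (IsHalf (opposite₁ e) f ⊎ IsHalf (opposite₂ e) f)

  -- The cycle e → e₁ → … → eₖ → e with es = e₁ ∷ … ∷ eₖ ∷ [], visiting
  -- no vertex twice.

  IsDirectedCycle : TwoEdge m n → List (TwoEdge m n) → Set
  IsDirectedCycle e es =
    Linked Arc (e ∷ es ∷ʳ e) × UniqueSetoid.Unique twoEdgeSetoid (e ∷ es)

  ConditionS : Set
  ConditionS =
    (∀ e c → e ∈² E₂ → IsHalf c e → ¬ c ∈ᶜ E₁) ×
    (∀ e f c → e ∈² E₂ → f ∈² E₂ → e ≋̸ f → IsHalf c e → ¬ IsHalf c f)

  ConditionW1 : Set
  ConditionW1 = ∀ i k j l → i ≢ k → j ≢ l →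
    ¬ ((i , j) ∈ᶜ E₁ × (i , l) ∈ᶜ E₁ × (k , j) ∈ᶜ E₁ × (k , l) ∈ᶜ E₁)

  ConditionW2 : Set
  ConditionW2 = ∀ e es → IsDirectedCycle e es → ∃ λ f → es ≡ [ f ] × Complementary e f

  ConditionW2′ : Set
  ConditionW2′ = ∀ e → e ∈² E₂ → Nondegenerate e →
    ¬ (opposite₁ e ∈ᶜ E₁ × opposite₂ e ∈ᶜ E₁)

  ConditionW3 : Set
  ConditionW3 = ∀ e f → IsEdge e → IsEdge f → IsTwoEdge e ⊎ IsTwoEdge f →
    VertexDisjoint e f → Any Unoccupied (oppositeCells e f)

  graphForm : Form m n
  graphForm x y =
    foldr _+_ 0ℝ (map (oneEdgeSquare x y) E₁) + foldr _+_ 0ℝ (map (twoEdgeSquare x y) E₂)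

  Irreducible : Set
  Irreducible = HasSOSRank graphForm (length E₁ ℕ.+ length E₂)

{-# OPTIONS --safe #-}

-- Let u(c) be the vector of coefficients at the cell c in the given squares
-- and v(c) the vector of coefficients at c in another representation of the
-- form as a sum of s squares.  Polarisation gives
--   ⟨v(i,j), v(k,l)⟩ + ⟨v(i,l), v(k,j)⟩ = ⟨u(i,j), u(k,l)⟩ + ⟨u(i,l), u(k,j)⟩.
-- Hence the Gram matrices of v and u agree within a row or a column, v vanishes
-- on unoccupied cells, and agreement passes from a pair of cells to the
-- opposite pair.  By induction along 𝓓 the vector v is constant on every 2-edge:
-- for a complementary pair this is the equality case of Cauchy–Schwarz;
-- otherwise, if the opposite cells are occupied, they lie in two different
-- edges, one of them a 2-edge, on which v is already constant, and (W3) moves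
-- their inner product to cells where it is known to vanish.  With (W1) for pairs
-- of 1-edges this makes one vector per edge an orthonormal family in ℝˢ, so by
-- Bessel's inequality there are at most s edges.

module Submission where

open import Algebra.Bundles using (CommutativeRing)
import Algebra.Properties.Ring as Ringₚ
import Algebra.Properties.Semiring.Sum as Sum
import Algebra.Solver.Ring.NaturalCoefficients.Default as NaturalCoefficients
open import Data.Bool.Base using (if_then_else_)
open import Data.Fin.Base using (Fin; zero; suc; splitAt; join)
open import Data.Fin.Properties using (any?; injective⇒≤; splitAt-join; join-splitAt; _≟_)
open import Data.List.Base as List
  using (List; []; _∷_; [_]; _∷ʳ_; _++_; length; lookup; cartesianProduct)
import Data.List.Membership.DecPropositional as DecMembership
open import Data.List.Membership.Propositional using (_∈_; find)
open import Data.List.Membership.Propositional.Properties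
  using (∈-lookup; ∈-∃++; ∈-++⁻; ∈-cartesianProduct⁻; ∈-map⁻)
import Data.List.Membership.Setoid.Properties as SetoidMembership
open import Data.List.Properties using (length-++; ++-assoc; map-++)
open import Data.List.Relation.Unary.All as All using ([]; _∷_)
open import Data.List.Relation.Unary.AllPairs as AllPairs using ([]; _∷_)
import Data.List.Relation.Unary.AllPairs.Properties as AllPairsₚ
open import Data.List.Relation.Unary.Any as Any using (here; there)
open import Data.List.Relation.Unary.Any.Properties using (lookup-index)
open import Data.List.Relation.Unary.Linked as Linked using (Linked; []; [-]; _∷_)
import Data.List.Relation.Unary.Linked.Properties as Linkedₚ
open import Data.List.Relation.Unary.Unique.Propositional using (Unique)
open import Data.List.Relation.Unary.Unique.Propositional.Properties using (++⁺)
import Data.List.Relation.Unary.Unique.Setoid as UniqueSetoid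
open import Data.Nat.Base as ℕ using (ℕ; zero; suc; _≤_)
import Data.Nat.Properties as ℕₚ
open import Data.Product.Base using (_×_; _,_; proj₁; proj₂; ∃)
open import Data.Product.Properties using (≡-dec)
open import Data.Rational.Base as ℚ using (0ℚ; 1ℚ; ∣_∣)
import Data.Rational.Properties as ℚₚ
open import Data.Sum.Base as ⊎ using (_⊎_; inj₁; inj₂)
import Data.Sum.Properties as Sumₚ
open import Data.Vec.Functional using (Vector)
open import Defs using (AugmentedBipartiteGraph; ConditionS; ConditionW1; ConditionW2; ConditionW2′; ConditionW3; Irreducible)
open import Defs using
  ( TwoEdge; half₁; half₂; distinct; Cell; Edge; one; two; IsTwoEdge; isTwo
  ; cells; rows; columns; _∈ᶜ_; _∈²_; _≋_; twoEdgeSetoid; IsHalf; IsEdge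
  ; Nondegenerate; opposite₁; opposite₂; Complementary; Occupied; Unoccupied; Arc)
open import Function.Base using (_∘_)
open import Level using (0ℓ)
open import Relation.Binary.Bundles using (Setoid)
open import Relation.Binary.Core using (Rel)
open import Relation.Binary.PropositionalEquality as ≡ using (_≡_; _≢_)
open import Relation.Nullary using (¬_; Dec; yes; no; does; contradiction)
open import Relation.Nullary.Decidable using (map′; _⊎-dec_; _×-dec_)

-- Lists without repetition and linked lists.

lookup-injective : ∀ {a ℓ} (S : Setoid a ℓ) {xs} → UniqueSetoid.Unique S xs →
  ∀ {i j} → Setoid._≈_ S (lookup xs i) (lookup xs j) → i ≡ j
lookup-injective S (_ ∷ _) {zero}  {zero}  _  = ≡.refl
lookup-injective S (p ∷ _) {zero}  {suc j} eq = contradiction eq (All.lookup p (∈-lookup j))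
lookup-injective S (p ∷ _) {suc i} {zero}  eq =
  contradiction (Setoid.sym S eq) (All.lookup p (∈-lookup i))
lookup-injective S (_ ∷ u) {suc i} {suc j} eq = ≡.cong suc (lookup-injective S u eq)

module _ {a ℓ} {A : Set a} {R : Rel A ℓ} where

  ∷ʳ-linked : ∀ xs {x y} → Linked R (xs ∷ʳ x) → R x y → Linked R (xs ∷ʳ x ∷ʳ y)
  ∷ʳ-linked []           [-]     r = r ∷ [-]
  ∷ʳ-linked (_ ∷ [])     (q ∷ l) r = q ∷ ∷ʳ-linked [] l r
  ∷ʳ-linked (_ ∷ z ∷ xs) (q ∷ l) r = q ∷ ∷ʳ-linked (z ∷ xs) l r

  drop-linked : ∀ xs {ys} → Linked R (xs ++ ys) → Linked R ys
  drop-linked []       l = l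
  drop-linked (_ ∷ xs) l = drop-linked xs (Linked.tail l)

drop-unique : ∀ {a} {A : Set a} (xs : List A) {ys} → Unique (xs ++ ys) → Unique ys
drop-unique []       u       = u
drop-unique (_ ∷ xs) (_ ∷ u) = drop-unique xs u

-- Induction along a relation without simple cycles on a finite set.

module _ {N ℓ p} {R : Rel (Fin N) ℓ} {P : Fin N → Set p}
  (acyclic : ∀ x xs → Linked R (x ∷ xs ∷ʳ x) → ¬ Unique (x ∷ xs))
  (step : ∀ x → (∀ y → R x y → P y) → P x) where

  private
    open DecMembership (_≟_ {N}) using (_∈?_)

    -- The path xs ∷ʳ x visits no vertex twice, so it can be prolonged at
    -- most k more times before it closes up to a cycle.

    induct : ∀ k xs x → Linked R (xs ∷ʳ x) → Unique (xs ∷ʳ x) → N ℕ.≤ length xs ℕ.+ k → P x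
    -- Out of fuel, the path would consist of more than `N` distinct elements of `Fin N`.
    induct zero xs x _ u N≤ = contradiction
      (ℕₚ.≤-trans (injective⇒≤ (lookup-injective (≡.setoid _) u))
        (ℕₚ.≤-trans N≤ (ℕₚ.≤-reflexive (ℕₚ.+-identityʳ _))))
      (ℕₚ.<⇒≱ (ℕₚ.≤-reflexive (≡.trans (ℕₚ.+-comm 1 _) (≡.sym (length-++ xs)))))
    induct (suc k) xs x l u N≤ = step x next
      where
      next : ∀ y → R x y → P y
      next y r with y ∈? (xs ∷ʳ x)
      ... | no y∉ = induct k (xs ∷ʳ x) y (∷ʳ-linked xs l r)
        (++⁺ u ([] ∷ []) λ { (∈xs , here ≡.refl) → y∉ ∈xs })
        (ℕₚ.≤-trans N≤ (ℕₚ.≤-reflexive (≡.trans (≡.sym (ℕₚ.+-assoc (length xs) 1 k))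
          (≡.cong (ℕ._+ k) (≡.sym (length-++ xs))))))
      -- A return to a visited vertex `y` closes up the tail `y ∷ zs` of the path to a simple cycle.
      ... | yes y∈ with ys , zs , eq ← ∈-∃++ y∈ = contradiction
        (drop-unique ys (≡.subst Unique eq u))
        (acyclic y zs (drop-linked ys (≡.subst (Linked R)
          (≡.trans (≡.cong (_∷ʳ y) eq) (++-assoc ys (y ∷ zs) [ y ])) (∷ʳ-linked xs l r))))

  acyclic-induction : ∀ x → P x
  acyclic-induction x = induct N [] x [-] ([] ∷ []) ℕₚ.≤-refl

-- Cells and the edges that own them.

module _ {m n} (G : AugmentedBipartiteGraph m n) where

  open AugmentedBipartiteGraph G

  private
    _≟ᶜ_ : (c d : Cell m n) → Dec (c ≡ d)
    _≟ᶜ_ = ≡-dec _≟_ _≟_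

    open DecMembership _≟ᶜ_ using () renaming (_∈?_ to _∈ᶜ?_)

  -- Edges are named by their positions in the two lists: positions have decidable equality and can
  -- be searched, whereas 2-edges are compared only up to `_≋_`.
  Index : Set
  Index = Fin (length E₁) ⊎ Fin (length E₂)

  edge : Index → Edge m n
  edge (inj₁ i) = one (lookup E₁ i)
  edge (inj₂ j) = two (lookup E₂ j)

  infix 4 _∈ᵉ_ _∈ᵉ?_

  _∈ᵉ_ : Cell m n → Index → Set
  c ∈ᵉ p = c ∈ cells (edge p)

  _∈ᵉ?_ : ∀ c p → Dec (c ∈ᵉ p)
  c ∈ᵉ? p = c ∈ᶜ? cells (edge p)

  isEdge : ∀ p → IsEdge G (edge p)
  isEdge (inj₁ i) = ∈-lookup i
  isEdge (inj₂ j) = SetoidMembership.∈-lookup twoEdgeSetoid E₂ j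

  ∈⇒half : ∀ {c} (e : TwoEdge m n) → c ∈ cells (two e) → IsHalf c e
  ∈⇒half _ (here eq)         = inj₁ eq
  ∈⇒half _ (there (here eq)) = inj₂ eq

  half⇒∈ : ∀ {c} (e : TwoEdge m n) → IsHalf c e → c ∈ cells (two e)
  half⇒∈ _ (inj₁ eq) = here eq
  half⇒∈ _ (inj₂ eq) = there (here eq)

  half-resp-≋ : ∀ {c} (e f : TwoEdge m n) → e ≋ f → IsHalf c e → IsHalf c f
  half-resp-≋ _ _ (inj₁ (≡.refl , ≡.refl)) h        = h
  half-resp-≋ _ _ (inj₂ (≡.refl , ≡.refl)) (inj₁ h) = inj₂ h
  half-resp-≋ _ _ (inj₂ (≡.refl , ≡.refl)) (inj₂ h) = inj₁ h

  half-owned : ∀ {c} e (e∈ : e ∈² E₂) → IsHalf c e → c ∈ᵉ inj₂ (Any.index e∈)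
  half-owned e e∈ h = half⇒∈ f (half-resp-≋ e f (lookup-index e∈) h)
    where f = lookup E₂ (Any.index e∈)

  occupied⇒owned : ∀ {c} → Occupied G c → ∃ λ p → c ∈ᵉ p
  occupied⇒owned (inj₁ c∈) = inj₁ (Any.index c∈) , here (lookup-index c∈)
  occupied⇒owned (inj₂ (e , e∈ , h)) = inj₂ (Any.index e∈) , half-owned e e∈ h

  owned⇒occupied : ∀ {c} p → c ∈ᵉ p → Occupied G c
  owned⇒occupied (inj₁ i) (here ≡.refl) = inj₁ (∈-lookup i)
  owned⇒occupied (inj₂ j) c∈ = inj₂ (lookup E₂ j , isEdge (inj₂ j) , ∈⇒half (lookup E₂ j) c∈)

  -- Separates the pairs of edges to which (W3) applies from the pairs of 1-edges.
  isTwoEdge-or-∈E₁ : ∀ p {c} → c ∈ᵉ p → IsTwoEdge (edge p) ⊎ c ∈ᶜ E₁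
  isTwoEdge-or-∈E₁ (inj₁ i) (here ≡.refl) = inj₂ (∈-lookup i)
  isTwoEdge-or-∈E₁ (inj₂ j) _             = inj₁ isTwo

  infix 4 _≟ᵉ_

  _≟ᵉ_ : (p q : Index) → Dec (p ≡ q)
  _≟ᵉ_ = Sumₚ.≡-dec _≟_ _≟_

  -- A finite search over positions; it makes the case distinctions on occupied opposite cells
  -- constructive.
  owner? : ∀ c → Dec (∃ λ p → c ∈ᵉ p)
  owner? c = map′
    (λ { (inj₁ (i , c∈)) → inj₁ i , c∈ ; (inj₂ (j , c∈)) → inj₂ j , c∈ })
    (λ { (inj₁ i , c∈) → inj₁ (i , c∈) ; (inj₂ j , c∈) → inj₂ (j , c∈) })
    (any? (λ i → c ∈ᵉ? inj₁ i) ⊎-dec any? (λ j → c ∈ᵉ? inj₂ j))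

  -- Two 1-edges are separated by the uniqueness of `E₁`, a 1-edge and a 2-edge by the first clause
  -- of (S), two 2-edges by the second clause.
  owner-unique : ConditionS G → ∀ {c} p q → c ∈ᵉ p → c ∈ᵉ q → p ≡ q
  owner-unique _ (inj₁ i) (inj₁ i′) (here eq) (here eq′) =
    ≡.cong inj₁ (lookup-injective (≡.setoid _) E₁-unique (≡.trans (≡.sym eq) eq′))
  owner-unique (S₁ , _) (inj₁ i) (inj₂ j) (here ≡.refl) c∈ =
    contradiction (∈-lookup i) (S₁ (lookup E₂ j) _ (isEdge (inj₂ j)) (∈⇒half (lookup E₂ j) c∈))
  owner-unique (S₁ , _) (inj₂ j) (inj₁ i) c∈ (here ≡.refl) =
    contradiction (∈-lookup i) (S₁ (lookup E₂ j) _ (isEdge (inj₂ j)) (∈⇒half (lookup E₂ j) c∈))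
  owner-unique (_ , S₂) (inj₂ j) (inj₂ j′) c∈ c∈′ with j ≟ j′
  ... | yes ≡.refl = ≡.refl
  ... | no j≢j′ = contradiction (∈⇒half (lookup E₂ j′) c∈′)
    (S₂ (lookup E₂ j) (lookup E₂ j′) _ (isEdge (inj₂ j)) (isEdge (inj₂ j′))
    (j≢j′ ∘ lookup-injective twoEdgeSetoid E₂-unique) (∈⇒half (lookup E₂ j) c∈))

  -- The dependency graph.

  -- Vertices with a complementary partner are left out, which makes the
  -- 2-cycles permitted by (W2) disappear.

  UnpairedArc : Rel (Fin (length E₂)) 0ℓ
  UnpairedArc j j′ = Arc G (lookup E₂ j) (lookup E₂ j′) ×
    (∀ f → f ∈² E₂ → ¬ Complementary (lookup E₂ j) f)

  -- By (W2) a cycle could only be a 2-cycle of complementary 2-edges, but the source of an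
  -- `UnpairedArc` has no complementary partner.
  unpairedArc-acyclic : ConditionW2 G →
    ∀ j js → Linked UnpairedArc (j ∷ js ∷ʳ j) → ¬ Unique (j ∷ js)
  unpairedArc-acyclic W2 j js l u
    with W2 (lookup E₂ j) (List.map (lookup E₂) js)
      ( ≡.subst (Linked (Arc G)) (≡.cong (lookup E₂ j ∷_) (map-++ (lookup E₂) js [ j ]))
          (Linkedₚ.map⁺ (Linked.map proj₁ l))
      , AllPairsₚ.map⁺ (AllPairs.map
          (λ j≢ eq → j≢ (lookup-injective twoEdgeSetoid E₂-unique eq)) u))
  unpairedArc-acyclic W2 j (j′ ∷ []) (r ∷ _) u | f , ≡.refl , comp =
    proj₂ r f (isEdge (inj₂ j′)) comp

  -- A complementary partner would own both opposite cells and force `q ≡ r`. So when the owners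
  -- differ, the induction along 𝓓 reaches each of them that is a nondegenerate 2-edge.
  unpairedArc : ConditionS G → ∀ j → Nondegenerate (lookup E₂ j) →
    ∀ {q r} → opposite₁ (lookup E₂ j) ∈ᵉ q → opposite₂ (lookup E₂ j) ∈ᵉ r → q ≢ r →
    ∀ j′ → Nondegenerate (lookup E₂ j′) → inj₂ j′ ≡ q ⊎ inj₂ j′ ≡ r → UnpairedArc j j′
  unpairedArc S j nd {q} {r} o₁∈ o₂∈ q≢r j′ nd′ j′≡ =
    ( (isEdge (inj₂ j) , nd) , (isEdge (inj₂ j′) , nd′)
    -- Otherwise an opposite cell of `e` would be a half of `e`, against nondegeneracy.
    , (λ e≋f → distinct-from (hit e≋f j′≡))
    , owned⇒occupied q o₁∈ , owned⇒occupied r o₂∈ , meets j′≡ ) , unpaired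
    where
    e f : TwoEdge m n
    e = lookup E₂ j
    f = lookup E₂ j′

    meets : inj₂ j′ ≡ q ⊎ inj₂ j′ ≡ r → IsHalf (opposite₁ e) f ⊎ IsHalf (opposite₂ e) f
    meets (inj₁ ≡.refl) = inj₁ (∈⇒half f o₁∈)
    meets (inj₂ ≡.refl) = inj₂ (∈⇒half f o₂∈)

    hit : e ≋ f → inj₂ j′ ≡ q ⊎ inj₂ j′ ≡ r → IsHalf (opposite₁ e) e ⊎ IsHalf (opposite₂ e) e
    hit e≋f j′≡ with meets j′≡
    ... | inj₁ h = inj₁ (half-resp-≋ f e (Setoid.sym twoEdgeSetoid {e} {f} e≋f) h)
    ... | inj₂ h = inj₂ (half-resp-≋ f e (Setoid.sym twoEdgeSetoid {e} {f} e≋f) h)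

    distinct-from : ¬ (IsHalf (opposite₁ e) e ⊎ IsHalf (opposite₂ e) e)
    distinct-from (inj₁ (inj₁ eq)) = proj₂ nd (≡.sym (≡.cong proj₂ eq))
    distinct-from (inj₁ (inj₂ eq)) = proj₁ nd (≡.cong proj₁ eq)
    distinct-from (inj₂ (inj₁ eq)) = proj₁ nd (≡.sym (≡.cong proj₁ eq))
    distinct-from (inj₂ (inj₂ eq)) = proj₂ nd (≡.cong proj₂ eq)

    unpaired : ∀ g → g ∈² E₂ → ¬ Complementary e g
    unpaired g g∈ (_ , _ , inj₁ (≡.refl , ≡.refl)) = q≢r (≡.trans
      (owner-unique S q (inj₂ (Any.index g∈)) o₁∈ (half-owned g g∈ (inj₁ ≡.refl)))
      (owner-unique S _ r (half-owned g g∈ (inj₂ ≡.refl)) o₂∈))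
    unpaired g g∈ (_ , _ , inj₂ (≡.refl , ≡.refl)) = q≢r (≡.trans
      (owner-unique S q (inj₂ (Any.index g∈)) o₁∈ (half-owned g g∈ (inj₂ ≡.refl)))
      (owner-unique S _ r (half-owned g g∈ (inj₁ ≡.refl)) o₂∈))

  -- Contact between two edges.

  -- Each constructor supplies a cell of `p` and a cell of `q` at which the two Gram matrices will
  -- be known to agree: directly within a row or column, or through an unoccupied opposite cell.
  data Contact (p q : Index) : Set where
    sameRow    : ∀ {i j l} → (i , j) ∈ᵉ p → (i , l) ∈ᵉ q → Contact p q
    sameColumn : ∀ {i k j} → (i , j) ∈ᵉ p → (k , j) ∈ᵉ q → Contact p q
    gap₁       : ∀ {i j k l} → (i , j) ∈ᵉ p → (k , l) ∈ᵉ q → Unoccupied G (i , l) → Contact p q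
    gap₂       : ∀ {i j k l} → (i , j) ∈ᵉ p → (k , l) ∈ᵉ q → Unoccupied G (k , j) → Contact p q

  private
    row⁻ : ∀ {i} p → i ∈ rows (edge p) → ∃ λ j → (i , j) ∈ᵉ p
    row⁻ p i∈ with (_ , j) , c∈ , ≡.refl ← ∈-map⁻ proj₁ i∈ = j , c∈

    column⁻ : ∀ {j} p → j ∈ columns (edge p) → ∃ λ i → (i , j) ∈ᵉ p
    column⁻ p j∈ with (i , _) , c∈ , ≡.refl ← ∈-map⁻ proj₂ j∈ = i , c∈

    _∩?_ : ∀ {k} (xs ys : List (Fin k)) → Dec (∃ λ x → x ∈ xs × x ∈ ys)
    xs ∩? ys = any? λ x → (x ∈? xs) ×-dec (x ∈? ys)
      where open DecMembership _≟_ using (_∈?_)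

  -- Edges with no common row or column are vertex-disjoint, so (W3) gives an unoccupied opposite
  -- cell; the edge contributing its row decides between `gap₁` and `gap₂`.
  contact : ConditionW3 G → ∀ p q → IsTwoEdge (edge p) ⊎ IsTwoEdge (edge q) → Contact p q
  contact W3 p q two? with rows (edge p) ∩? rows (edge q)
  ... | yes (i , i∈p , i∈q) = sameRow (proj₂ (row⁻ p i∈p)) (proj₂ (row⁻ q i∈q))
  ... | no ¬r with columns (edge p) ∩? columns (edge q)
  ...   | yes (j , j∈p , j∈q) = sameColumn (proj₂ (column⁻ p j∈p)) (proj₂ (column⁻ q j∈q))
  ...   | no ¬c
    with (i , l) , z∈ , free ← find (W3 (edge p) (edge q) (isEdge p) (isEdge q) two?
      ((λ { (x , y) → ¬r (_ , x , y) }) , (λ { (x , y) → ¬c (_ , x , y) })))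
    with ∈-++⁻ (cartesianProduct (rows (edge p)) (columns (edge q))) z∈
  ... | inj₁ z∈₁ with i∈ , l∈ ← ∈-cartesianProduct⁻ (rows (edge p)) (columns (edge q)) z∈₁ =
    gap₁ (proj₂ (row⁻ p i∈)) (proj₂ (column⁻ q l∈)) free
  ... | inj₂ z∈₂ with i∈ , l∈ ← ∈-cartesianProduct⁻ (rows (edge q)) (columns (edge p)) z∈₂ =
    gap₂ (proj₂ (column⁻ p l∈)) (proj₂ (row⁻ q i∈)) free

-- Formally real rings.

-- Neither decidable equality nor a total order is asked for, as Cauchy reals have neither
-- constructively. A cone containing the squares, in which a sum vanishes only if its summands do,
-- is enough.
record IsFormallyReal (R : CommutativeRing 0ℓ 0ℓ) : Set₁ where
  open CommutativeRing R
  field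
    NonNegative : Carrier → Set
    nonNeg-resp : ∀ {x y} → x ≈ y → NonNegative x → NonNegative y
    +-nonNeg    : ∀ {x y} → NonNegative x → NonNegative y → NonNegative (x + y)
    ²-nonNeg    : ∀ x → NonNegative (x * x)
    sum-zeroˡ   : ∀ {x y} → NonNegative x → NonNegative y → x + y ≈ 0# → x ≈ 0#
    reduced     : ∀ {x} → x * x ≈ 0# → x ≈ 0#
    1≉0         : ¬ 1# ≈ 0#

-- Polynomial identities.

module RingIdentities (R : CommutativeRing 0ℓ 0ℓ) where

  open CommutativeRing R using (Carrier; _≈_; _+_; _*_; refl; commutativeSemiring)
  open NaturalCoefficients commutativeSemiring using (solve; _:+_; _:*_; _:=_)

  distribute : ∀ a x x′ y → a * (x + x′) * y ≈ a * x * y + a * x′ * y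
  distribute = solve 4 (λ a x x′ y →
    a :* (x :+ x′) :* y := a :* x :* y :+ a :* x′ :* y) refl

  collect : ∀ a b x y → (a + b) * x * y ≈ a * x * y + b * x * y
  collect = solve 4 (λ a b x y →
    (a :+ b) :* x :* y := a :* x :* y :+ b :* x :* y) refl

  -- A semiring identity meant for `z = - y`, where the terms with the factor `z + y` vanish.
  complete-square : ∀ x y z → (x + z) * (x + z) + (x * y + x * y)
    ≈ (x * x + z * z) + (x * (z + y) + x * (z + y))
  complete-square = solve 3 (λ x y z →
    (x :+ z) :* (x :+ z) :+ (x :* y :+ x :* y)
      := (x :* x :+ z :* z) :+ (x :* (z :+ y) :+ x :* (z :+ y))) refl

  square-sum : ∀ a b c → (a + b) + (b + c) ≈ (a + c) + (b + b)
  square-sum = solve 3 (λ a b c →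
    (a :+ b) :+ (b :+ c) := (a :+ c) :+ (b :+ b)) refl

  inner : ∀ a b c d → (a + b) + (c + d) ≈ (a + d) + (b + c)
  inner = solve 4 (λ a b c d →
    (a :+ b) :+ (c :+ d) := (a :+ d) :+ (b :+ c)) refl

  interchange : ∀ x y → (x * x) * (y * y) ≈ (x * y) * (x * y)
  interchange = solve 2 (λ x y → (x :* x) :* (y :* y) := (x :* y) :* (x :* y)) refl

  rotate : ∀ x y z → x * (y * z) ≈ y * (x * z)
  rotate = solve 3 (λ x y z →
    x :* (y :* z) := y :* (x :* z)) refl

  shuffle : ∀ a b c d → a * b * c * d ≈ b * (a * (c * d))
  shuffle = solve 4 (λ a b c d →
    a :* b :* c :* d := b :* (a :* (c :* d))) refl

  double-sum : ∀ x y → (x + y) + (x + y) ≈ (x + x) + (y + y)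
  double-sum = solve 2 (λ x y →
    (x :+ y) :+ (x :+ y) := (x :+ x) :+ (y :+ y)) refl

  factor : ∀ x → x * x + x * x ≈ x * (x + x)
  factor = solve 1 (λ x →
    x :* x :+ x :* x := x :* (x :+ x)) refl

  regroup : ∀ a b c d → (a + b) + ((c + d) + (c + d)) ≈ (a + (c + c)) + (b + (d + d))
  regroup = solve 4 (λ a b c d →
    (a :+ b) :+ ((c :+ d) :+ (c :+ d)) := (a :+ (c :+ c)) :+ (b :+ (d :+ d))) refl

  regroup′ : ∀ a b c d → (a + (b + c)) + d ≈ c + (a + (d + b))
  regroup′ = solve 4 (λ a b c d →
    (a :+ (b :+ c)) :+ d := c :+ (a :+ (d :+ b))) refl

-- Finite sums, inner products and bilinear forms.

module Bilinear (R : CommutativeRing 0ℓ 0ℓ) where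

  open CommutativeRing R hiding (zero; ring)
  open Sum semiring public
    using (sum; sum-cong-≋; ∑-distrib-+; ∑-comm; *-distribˡ-sum; sum-replicate-zero)
  open import Relation.Binary.Reasoning.Setoid setoid
  open Ringₚ (CommutativeRing.ring R)
    using (+-cancelˡ; +-cancelʳ; -‿distribˡ-*; -‿distribʳ-*; -‿involutive)
  open RingIdentities R

  square-difference : ∀ x y → (x - y) * (x - y) + (x * y + x * y) ≈ x * x + y * y
  square-difference x y = begin
    (x - y) * (x - y) + (x * y + x * y)
      ≈⟨ complete-square x y (- y) ⟩
    (x * x + - y * - y) + (x * (- y + y) + x * (- y + y))
      ≈⟨ +-cong (+-congˡ sign) (+-cong vanish vanish) ⟩
    (x * x + y * y) + (0# + 0#)
      ≈⟨ trans (+-congˡ (+-identityˡ 0#)) (+-identityʳ _) ⟩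
    x * x + y * y ∎
    where
    sign : - y * - y ≈ y * y
    sign = trans (sym (-‿distribˡ-* y (- y)))
      (trans (-‿cong (sym (-‿distribʳ-* y y))) (-‿involutive _))
    vanish : x * (- y + y) ≈ 0#
    vanish = trans (*-congˡ (-‿inverseˡ y)) (zeroʳ x)

  sum-zero : ∀ {k} {f : Vector Carrier k} → (∀ i → f i ≈ 0#) → sum f ≈ 0#
  sum-zero {k} f≈0 = trans (sum-cong-≋ f≈0) (sum-replicate-zero k)

  sum-single : ∀ {k} (f : Vector Carrier k) i → (∀ j → j ≢ i → f j ≈ 0#) → sum f ≈ f i
  sum-single f zero    f≈0 = trans (+-congˡ (sum-zero λ j → f≈0 (suc j) λ ())) (+-identityʳ _)
  sum-single f (suc i) f≈0 = trans
    (+-cong (f≈0 zero λ ()) (sum-single (f ∘ suc) i λ j j≢i →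
      f≈0 (suc j) λ { ≡.refl → j≢i ≡.refl }))
    (+-identityˡ _)

  sum-splitAt : ∀ a {b} (F : Fin a ⊎ Fin b → Carrier) →
    sum (F ∘ splitAt a) ≈ sum (F ∘ inj₁) + sum (F ∘ inj₂)
  sum-splitAt zero    F = sym (+-identityˡ _)
  sum-splitAt (suc a) F = trans (+-congˡ (sum-splitAt a (F ∘ ⊎.map₁ suc))) (sym (+-assoc _ _ _))

  ones-+ : ∀ a b → sum {a ℕ.+ b} (λ _ → 1#) ≈ sum {a} (λ _ → 1#) + sum {b} (λ _ → 1#)
  ones-+ zero    b = sym (+-identityˡ _)
  ones-+ (suc a) b = trans (+-congˡ (ones-+ a b)) (sym (+-assoc _ _ _))

  -- Used both as the Kronecker symbol and, partially applied, as a standard basis vector.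
  δ : ∀ {k} → Fin k → Vector Carrier k
  δ i j = if does (i ≟ j) then 1# else 0#

  δ-refl : ∀ {k} (i : Fin k) → δ i i ≈ 1#
  δ-refl i with i ≟ i
  ... | yes _  = refl
  ... | no i≢i = contradiction ≡.refl i≢i

  δ-distinct : ∀ {k} {i j : Fin k} → i ≢ j → δ i j ≈ 0#
  δ-distinct {i = i} {j} i≢j with i ≟ j
  ... | yes i≡j = contradiction i≡j i≢j
  ... | no _    = refl

  sum-δˡ : ∀ {k} i (f : Vector Carrier k) → sum (λ j → δ i j * f j) ≈ f i
  sum-δˡ i f = trans
    (sum-single _ i λ j j≢i → trans (*-congʳ (δ-distinct (j≢i ∘ ≡.sym))) (zeroˡ _))
    (trans (*-congʳ (δ-refl i)) (*-identityˡ _))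

  infix 8 _∙_

  _∙_ : ∀ {k} → Vector Carrier k → Vector Carrier k → Carrier
  f ∙ g = sum λ p → f p * g p

  ∙-cong : ∀ {k} {f f′ g g′ : Vector Carrier k} →
    (∀ p → f p ≈ f′ p) → (∀ p → g p ≈ g′ p) → f ∙ g ≈ f′ ∙ g′
  ∙-cong f≈ g≈ = sum-cong-≋ λ p → *-cong (f≈ p) (g≈ p)

  ∙-comm : ∀ {k} (f g : Vector Carrier k) → f ∙ g ≈ g ∙ f
  ∙-comm f g = sum-cong-≋ λ p → *-comm (f p) (g p)

  ∙-zeroˡ : ∀ {k} {f : Vector Carrier k} g → (∀ p → f p ≈ 0#) → f ∙ g ≈ 0#
  ∙-zeroˡ g f≈0 = sum-zero λ p → trans (*-congʳ (f≈0 p)) (zeroˡ (g p))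

  ∙-distribˡ : ∀ {k} (f g h : Vector Carrier k) → f ∙ (λ p → g p + h p) ≈ f ∙ g + f ∙ h
  ∙-distribˡ f g h = trans (sum-cong-≋ λ p → distribˡ (f p) (g p) (h p))
    (∑-distrib-+ (λ p → f p * g p) (λ p → f p * h p))

  ∙-distribʳ : ∀ {k} (f g h : Vector Carrier k) → (λ p → g p + h p) ∙ f ≈ g ∙ f + h ∙ f
  ∙-distribʳ f g h = trans (sum-cong-≋ λ p → distribʳ (f p) (g p) (h p))
    (∑-distrib-+ (λ p → g p * f p) (λ p → h p * f p))

  ∙-combinationʳ : ∀ {k l} (f : Vector Carrier k) (c : Vector Carrier l)
    (w : Fin l → Vector Carrier k) →
    f ∙ (λ t → sum λ a → c a * w a t) ≈ sum λ a → c a * f ∙ w a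
  ∙-combinationʳ f c w = begin
    sum (λ t → f t * sum (λ a → c a * w a t))
      ≈⟨ sum-cong-≋ (λ t → *-distribˡ-sum (f t) (λ a → c a * w a t)) ⟩
    sum (λ t → sum (λ a → f t * (c a * w a t)))
      ≈⟨ ∑-comm (λ t a → f t * (c a * w a t)) ⟩
    sum (λ a → sum (λ t → f t * (c a * w a t)))
      ≈⟨ sum-cong-≋ (λ a → sum-cong-≋ (λ t → rotate (f t) (c a) (w a t))) ⟩
    sum (λ a → sum (λ t → c a * (f t * w a t)))
      ≈⟨ sum-cong-≋ (λ a → sym (*-distribˡ-sum (c a) (λ t → f t * w a t))) ⟩
    sum (λ a → c a * f ∙ w a) ∎

  ∙-sum-square : ∀ {k} (f g : Vector Carrier k) →
    (λ p → f p + g p) ∙ (λ p → f p + g p) ≈ (f ∙ f + g ∙ g) + (f ∙ g + f ∙ g)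
  ∙-sum-square f g = begin
    (λ p → f p + g p) ∙ (λ p → f p + g p)
      ≈⟨ ∙-distribʳ _ f g ⟩
    f ∙ (λ p → f p + g p) + g ∙ (λ p → f p + g p)
      ≈⟨ +-cong (∙-distribˡ f f g) (∙-distribˡ g f g) ⟩
    (f ∙ f + f ∙ g) + (g ∙ f + g ∙ g)
      ≈⟨ +-congˡ (+-congʳ (∙-comm g f)) ⟩
    (f ∙ f + f ∙ g) + (f ∙ g + g ∙ g)
      ≈⟨ square-sum _ _ _ ⟩
    (f ∙ f + g ∙ g) + (f ∙ g + f ∙ g) ∎

  ∙-difference-square : ∀ {k} (f g : Vector Carrier k) →
    (λ p → f p - g p) ∙ (λ p → f p - g p) + (f ∙ g + f ∙ g) ≈ f ∙ f + g ∙ g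
  ∙-difference-square f g = begin
    (λ p → f p - g p) ∙ (λ p → f p - g p) + (f ∙ g + f ∙ g)
      ≈⟨ +-congˡ (sym (∑-distrib-+ (λ p → f p * g p) (λ p → f p * g p))) ⟩
    (λ p → f p - g p) ∙ (λ p → f p - g p) + sum (λ p → f p * g p + f p * g p)
      ≈⟨ sym (∑-distrib-+ (λ p → (f p - g p) * (f p - g p)) (λ p → f p * g p + f p * g p)) ⟩
    sum (λ p → (f p - g p) * (f p - g p) + (f p * g p + f p * g p))
      ≈⟨ sum-cong-≋ (λ p → square-difference (f p) (g p)) ⟩
    sum (λ p → f p * f p + g p * g p)
      ≈⟨ ∑-distrib-+ (λ p → f p * f p) (λ p → g p * g p) ⟩
    f ∙ f + g ∙ g ∎

  Matrix : ℕ → ℕ → Set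
  Matrix m n = Fin m → Fin n → Carrier

  bilinear : ∀ {m n} → Matrix m n → Vector Carrier m → Vector Carrier n → Carrier
  bilinear b x y = sum λ i → sum λ j → b i j * x i * y j

  -- A family of `k` bilinear forms is read as one bilinear map into `k`-space: its sum of squares
  -- is a squared norm, and `entries` gives its values at pairs of basis vectors.
  values : ∀ {k m n} → (Fin k → Matrix m n) → Vector Carrier m → Vector Carrier n → Vector Carrier k
  values c x y p = bilinear (c p) x y

  entries : ∀ {k m n} → (Fin k → Matrix m n) → Fin m → Fin n → Vector Carrier k
  entries c i j p = c p i j

  sumOfSquares : ∀ {k m n} → (Fin k → Matrix m n) → Vector Carrier m → Vector Carrier n → Carrier
  sumOfSquares c x y = values c x y ∙ values c x y

  bilinear-+ˡ : ∀ {m n} (b : Matrix m n) x x′ y →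
    bilinear b (λ i → x i + x′ i) y ≈ bilinear b x y + bilinear b x′ y
  bilinear-+ˡ b x x′ y = trans
    (sum-cong-≋ λ i → trans (sum-cong-≋ λ j → distribute (b i j) (x i) (x′ i) (y j))
      (∑-distrib-+ (λ j → b i j * x i * y j) (λ j → b i j * x′ i * y j)))
    (∑-distrib-+ (λ i → sum λ j → b i j * x i * y j) (λ i → sum λ j → b i j * x′ i * y j))

  bilinear-+ʳ : ∀ {m n} (b : Matrix m n) x y y′ →
    bilinear b x (λ j → y j + y′ j) ≈ bilinear b x y + bilinear b x y′
  bilinear-+ʳ b x y y′ = trans
    (sum-cong-≋ λ i → trans (sum-cong-≋ λ j → distribˡ (b i j * x i) (y j) (y′ j))
      (∑-distrib-+ (λ j → b i j * x i * y j) (λ j → b i j * x i * y′ j)))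
    (∑-distrib-+ (λ i → sum λ j → b i j * x i * y j) (λ i → sum λ j → b i j * x i * y′ j))

  bilinear-+ : ∀ {m n} (b b′ : Matrix m n) x y →
    bilinear (λ i j → b i j + b′ i j) x y ≈ bilinear b x y + bilinear b′ x y
  bilinear-+ b b′ x y = trans
    (sum-cong-≋ λ i → trans (sum-cong-≋ λ j → collect (b i j) (b′ i j) (x i) (y j))
      (∑-distrib-+ (λ j → b i j * x i * y j) (λ j → b′ i j * x i * y j)))
    (∑-distrib-+ (λ i → sum λ j → b i j * x i * y j) (λ i → sum λ j → b′ i j * x i * y j))

  bilinear-δ : ∀ {m n} (b : Matrix m n) i j → bilinear b (δ i) (δ j) ≈ b i j
  bilinear-δ b i j = begin
    sum (λ k → sum λ l → b k l * δ i k * δ j l)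
      ≈⟨ sum-cong-≋ (λ k → sum-cong-≋ λ l → *-comm (b k l * δ i k) (δ j l)) ⟩
    sum (λ k → sum λ l → δ j l * (b k l * δ i k))
      ≈⟨ sum-cong-≋ (λ k → sum-δˡ j (λ l → b k l * δ i k)) ⟩
    sum (λ k → b k j * δ i k)
      ≈⟨ sum-cong-≋ (λ k → *-comm (b k j) (δ i k)) ⟩
    sum (λ k → δ i k * b k j)
      ≈⟨ sum-δˡ i (λ k → b k j) ⟩
    b i j ∎

  bilinear-δδ : ∀ {m n} i j (x : Vector Carrier m) (y : Vector Carrier n) →
    bilinear (λ k l → δ i k * δ j l) x y ≈ x i * y j
  bilinear-δδ i j x y = begin
    sum (λ k → sum λ l → δ i k * δ j l * x k * y l)
      ≈⟨ sum-cong-≋ (λ k → sum-cong-≋ λ l → shuffle (δ i k) (δ j l) (x k) (y l)) ⟩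
    sum (λ k → sum λ l → δ j l * (δ i k * (x k * y l)))
      ≈⟨ sum-cong-≋ (λ k → sum-δˡ j (λ l → δ i k * (x k * y l))) ⟩
    sum (λ k → δ i k * (x k * y j))
      ≈⟨ sum-δˡ i (λ k → x k * y j) ⟩
    x i * y j ∎

  -- Positivity, polarisation and orthonormal families.

  module _ (real : IsFormallyReal R) where

    open IsFormallyReal real

    difference-zero : ∀ {x y} → x - y ≈ 0# → x ≈ y
    difference-zero {x} {y} eq = +-cancelʳ (- y) x y (trans eq (sym (-‿inverseʳ y)))

    -- Halving without division: for `d = x - y` the sum `d * d + d * d` equals `d * (d + d)`, which
    -- is zero, so `d * d` and then `d` vanish.
    double-cancel : ∀ {x y} → x + x ≈ y + y → x ≈ y
    double-cancel {x} {y} eq = difference-zero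
      (reduced (sum-zeroˡ (²-nonNeg (x - y)) (²-nonNeg (x - y)) (begin
        (x - y) * (x - y) + (x - y) * (x - y)  ≈⟨ factor (x - y) ⟩
        (x - y) * ((x - y) + (x - y))          ≈⟨ *-congˡ (double-sum x (- y)) ⟩
        (x - y) * ((x + x) + (- y - y))        ≈⟨ *-congˡ (+-congʳ eq) ⟩
        (x - y) * ((y + y) + (- y - y))        ≈⟨ *-congˡ (sym (double-sum y (- y))) ⟩
        (x - y) * ((y - y) + (y - y))          ≈⟨ *-congˡ (+-cong (-‿inverseʳ y) (-‿inverseʳ y)) ⟩
        (x - y) * (0# + 0#)                    ≈⟨ *-congˡ (+-identityˡ 0#) ⟩
        (x - y) * 0#                           ≈⟨ zeroʳ (x - y) ⟩
        0#                                     ∎)))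

    sum-nonNeg : ∀ {k} {f : Vector Carrier k} → (∀ i → NonNegative (f i)) → NonNegative (sum f)
    sum-nonNeg {zero}  _  = nonNeg-resp (zeroˡ 0#) (²-nonNeg 0#)
    sum-nonNeg {suc k} f≥ = +-nonNeg (f≥ zero) (sum-nonNeg (f≥ ∘ suc))

    sum-zero⁻ : ∀ {k} {f : Vector Carrier k} → (∀ i → NonNegative (f i)) →
      sum f ≈ 0# → ∀ i → f i ≈ 0#
    sum-zero⁻ f≥ eq zero    = sum-zeroˡ (f≥ zero) (sum-nonNeg (f≥ ∘ suc)) eq
    sum-zero⁻ f≥ eq (suc i) = sum-zero⁻ (f≥ ∘ suc)
      (sum-zeroˡ (sum-nonNeg (f≥ ∘ suc)) (f≥ zero) (trans (+-comm _ _) eq)) i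

    ∙-nonNeg : ∀ {k} (f : Vector Carrier k) → NonNegative (f ∙ f)
    ∙-nonNeg f = sum-nonNeg (²-nonNeg ∘ f)

    ∙-definite : ∀ {k} (f : Vector Carrier k) → f ∙ f ≈ 0# → ∀ p → f p ≈ 0#
    ∙-definite f eq p = reduced (sum-zero⁻ (²-nonNeg ∘ f) eq p)

    -- Equality case of Cauchy–Schwarz: |f − g|² + |f′ − g′|² = 0.

    unit-vectors-agree : ∀ {k} (f g f′ g′ : Vector Carrier k) →
      f ∙ f ≈ 1# → g ∙ g ≈ 1# → f′ ∙ f′ ≈ 1# → g′ ∙ g′ ≈ 1# →
      f ∙ g + f′ ∙ g′ ≈ 1# + 1# → ∀ p → f p ≈ g p
    unit-vectors-agree f g f′ g′ f₁ g₁ f′₁ g′₁ eq p =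
      difference-zero (∙-definite h (sum-zeroˡ (∙-nonNeg h) (∙-nonNeg h′) (+-cancelʳ _ _ _ (begin
        (h ∙ h + h′ ∙ h′) + ((f ∙ g + f′ ∙ g′) + (f ∙ g + f′ ∙ g′))
          ≈⟨ regroup (h ∙ h) (h′ ∙ h′) (f ∙ g) (f′ ∙ g′) ⟩
        (h ∙ h + (f ∙ g + f ∙ g)) + (h′ ∙ h′ + (f′ ∙ g′ + f′ ∙ g′))
          ≈⟨ +-cong (∙-difference-square f g) (∙-difference-square f′ g′) ⟩
        (f ∙ f + g ∙ g) + (f′ ∙ f′ + g′ ∙ g′)
          ≈⟨ +-cong (+-cong f₁ g₁) (+-cong f′₁ g′₁) ⟩
        (1# + 1#) + (1# + 1#)
          ≈⟨ sym (+-cong eq eq) ⟩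
        (f ∙ g + f′ ∙ g′) + (f ∙ g + f′ ∙ g′)
          ≈⟨ sym (+-identityˡ _) ⟩
        0# + ((f ∙ g + f′ ∙ g′) + (f ∙ g + f′ ∙ g′)) ∎))) p)
      where
      h h′ : Vector Carrier _
      h  p = f p - g p
      h′ p = f′ p - g′ p

    -- Expanding the squared norm of a sum leaves twice the inner product; `double-cancel` removes
    -- the factor.
    polarise : ∀ {k l} (f g : Vector Carrier k) (f′ g′ : Vector Carrier l) →
      f ∙ f ≈ f′ ∙ f′ → g ∙ g ≈ g′ ∙ g′ →
      (λ p → f p + g p) ∙ (λ p → f p + g p) ≈ (λ p → f′ p + g′ p) ∙ (λ p → f′ p + g′ p) →
      f ∙ g ≈ f′ ∙ g′
    polarise f g f′ g′ ff gg ss = double-cancel (+-cancelˡ (f ∙ f + g ∙ g) _ _ (begin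
      (f ∙ f + g ∙ g) + (f ∙ g + f ∙ g)                ≈⟨ sym (∙-sum-square f g) ⟩
      (λ p → f p + g p) ∙ (λ p → f p + g p)            ≈⟨ ss ⟩
      (λ p → f′ p + g′ p) ∙ (λ p → f′ p + g′ p)        ≈⟨ ∙-sum-square f′ g′ ⟩
      (f′ ∙ f′ + g′ ∙ g′) + (f′ ∙ g′ + f′ ∙ g′)        ≈⟨ sym (+-congʳ (+-cong ff gg)) ⟩
      (f ∙ f + g ∙ g) + (f′ ∙ g′ + f′ ∙ g′)            ∎))

    -- Bessel: the part of the q-th basis vector orthogonal to w₁, …, wᵣ has
    -- squared norm 1 − Σₐ wₐ(q)²; these add up to s − r.

    orthonormal⇒≤ : ∀ {r s} (w : Fin r → Vector Carrier s) →
      (∀ a b → w a ∙ w b ≈ δ a b) → r ℕ.≤ s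
    orthonormal⇒≤ {r} {s} w orth = ℕₚ.≮⇒≥ λ s<r → 1≉0 (excess (ℕₚ.m≤n⇒∃[o]m+o≡n s<r))
      where
      proj z : Fin s → Vector Carrier s
      proj q t = sum λ a → w a q * w a t
      z q t = δ q t - proj q t

      ∙-proj : ∀ a q → w a ∙ proj q ≈ w a q
      ∙-proj a q = trans (∙-combinationʳ (w a) (λ b → w b q) w)
        (trans (sum-cong-≋ λ b → trans (*-comm (w b q) (w a ∙ w b)) (*-congʳ (orth a b)))
          (sum-δˡ a (λ b → w b q)))

      proj-∙-proj : ∀ q → proj q ∙ proj q ≈ proj q q
      proj-∙-proj q = trans (∙-combinationʳ (proj q) (λ a → w a q) w)
        (sum-cong-≋ λ a → *-congˡ (trans (∙-comm (proj q) (w a)) (∙-proj a q)))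

      residue : ∀ q → z q ∙ z q + proj q q ≈ 1#
      residue q = +-cancelʳ (proj q q) _ _ (begin
        (z q ∙ z q + proj q q) + proj q q
          ≈⟨ +-assoc _ _ _ ⟩
        z q ∙ z q + (proj q q + proj q q)
          ≈⟨ +-congˡ (sym (+-cong (sum-δˡ q (proj q)) (sum-δˡ q (proj q)))) ⟩
        z q ∙ z q + (δ q ∙ proj q + δ q ∙ proj q)
          ≈⟨ ∙-difference-square (δ q) (proj q) ⟩
        δ q ∙ δ q + proj q ∙ proj q
          ≈⟨ +-cong (trans (sum-δˡ q (δ q)) (δ-refl q)) (proj-∙-proj q) ⟩
        1# + proj q q ∎)

      trace : sum (λ q → proj q q) ≈ sum {r} (λ _ → 1#)
      trace = trans (∑-comm λ q a → w a q * w a q) (sum-cong-≋ λ a → trans (orth a a) (δ-refl a))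

      total : sum (λ q → z q ∙ z q) + sum {r} (λ _ → 1#) ≈ sum {s} (λ _ → 1#)
      total = trans (+-congˡ (sym trace))
        (trans (sym (∑-distrib-+ (λ q → z q ∙ z q) (λ q → proj q q))) (sum-cong-≋ residue))

      1-nonNeg : NonNegative 1#
      1-nonNeg = nonNeg-resp (*-identityˡ 1#) (²-nonNeg 1#)

      -- If `r` is `s + 1 + k`, then `total` says that `1 + k` plus a sum of squares is zero, hence
      -- `1#` is zero.
      excess : (∃ λ k → suc s ℕ.+ k ≡ r) → 1# ≈ 0#
      excess (k , ≡.refl) = sum-zeroˡ 1-nonNeg
        (+-nonNeg (sum-nonNeg {k} λ _ → 1-nonNeg) (sum-nonNeg (∙-nonNeg ∘ z)))
        (+-cancelʳ (sum {s} (λ _ → 1#)) _ _ (begin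
          (1# + (sum {k} (λ _ → 1#) + sum (λ q → z q ∙ z q))) + sum {s} (λ _ → 1#)
            ≈⟨ regroup′ 1# (sum {k} (λ _ → 1#)) (sum (λ q → z q ∙ z q)) (sum {s} (λ _ → 1#)) ⟩
          sum (λ q → z q ∙ z q) + (1# + (sum {s} (λ _ → 1#) + sum {k} (λ _ → 1#)))
            ≈⟨ +-congˡ (+-congˡ (sym (ones-+ s k))) ⟩
          sum (λ q → z q ∙ z q) + sum {suc s ℕ.+ k} (λ _ → 1#)
            ≈⟨ total ⟩
          sum {s} (λ _ → 1#)
            ≈⟨ sym (+-identityˡ _) ⟩
          0# + sum {s} (λ _ → 1#) ∎))

    -- Gram matrices of two representations of one form.

    module _ {m n s r} (b : Fin s → Matrix m n) (u : Fin r → Matrix m n)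
      (same : ∀ x y → sumOfSquares b x y ≈ sumOfSquares u x y) where

      private
        -- Polarisation in the second argument with `x` fixed; the first argument is handled by
        -- evaluating at sums of basis vectors.
        polarised : ∀ x y y′ → values b x y ∙ values b x y′ ≈ values u x y ∙ values u x y′
        polarised x y y′ = polarise (values b x y) (values b x y′) (values u x y) (values u x y′)
          (same x y) (same x y′)
          (trans (sym (sums b)) (trans (same x (λ j → y j + y′ j)) (sums u)))
          where
          sums : ∀ {k} (c : Fin k → Matrix m n) →
            values c x (λ j → y j + y′ j) ∙ values c x (λ j → y j + y′ j)
            ≈ (λ p → values c x y p + values c x y′ p) ∙ (λ p → values c x y p + values c x y′ p)
          sums c = ∙-cong (λ p → bilinear-+ʳ (c p) x y y′) (λ p → bilinear-+ʳ (c p) x y y′)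

        -- The first bracket collects the products within a row, which `gram-row` determines; the
        -- second is the mixed part.
        expand : ∀ {k} (c : Fin k → Matrix m n) i i′ j l →
          values c (λ t → δ i t + δ i′ t) (δ j) ∙ values c (λ t → δ i t + δ i′ t) (δ l)
          ≈ (entries c i j ∙ entries c i l + entries c i′ j ∙ entries c i′ l)
          + (entries c i j ∙ entries c i′ l + entries c i l ∙ entries c i′ j)
        expand c i i′ j l = begin
          values c (λ t → δ i t + δ i′ t) (δ j) ∙ values c (λ t → δ i t + δ i′ t) (δ l)
            ≈⟨ ∙-cong (value j) (value l) ⟩
          (λ p → ij p + i′j p) ∙ (λ p → il p + i′l p)
            ≈⟨ ∙-distribʳ (λ p → il p + i′l p) ij i′j ⟩
          ij ∙ (λ p → il p + i′l p) + i′j ∙ (λ p → il p + i′l p)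
            ≈⟨ +-cong (∙-distribˡ ij il i′l) (∙-distribˡ i′j il i′l) ⟩
          (ij ∙ il + ij ∙ i′l) + (i′j ∙ il + i′j ∙ i′l)
            ≈⟨ inner (ij ∙ il) (ij ∙ i′l) (i′j ∙ il) (i′j ∙ i′l) ⟩
          (ij ∙ il + i′j ∙ i′l) + (ij ∙ i′l + i′j ∙ il)
            ≈⟨ +-congˡ (+-congˡ (∙-comm i′j il)) ⟩
          (ij ∙ il + i′j ∙ i′l) + (ij ∙ i′l + il ∙ i′j) ∎
          where
          ij i′j il i′l : Vector Carrier _
          ij = entries c i j
          i′j = entries c i′ j
          il = entries c i l
          i′l = entries c i′ l
          value : ∀ j p → values c (λ t → δ i t + δ i′ t) (δ j) p ≈ c p i j + c p i′ j
          value j p = trans (bilinear-+ˡ (c p) (δ i) (δ i′) (δ j))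
            (+-cong (bilinear-δ (c p) i j) (bilinear-δ (c p) i′ j))

        at-δ : ∀ {k} (c : Fin k → Matrix m n) i j l →
          values c (δ i) (δ j) ∙ values c (δ i) (δ l) ≈ entries c i j ∙ entries c i l
        at-δ c i j l = ∙-cong (λ p → bilinear-δ (c p) i j) (λ p → bilinear-δ (c p) i l)

      gram-row : ∀ i j l → entries b i j ∙ entries b i l ≈ entries u i j ∙ entries u i l
      gram-row i j l = trans (sym (at-δ b i j l))
        (trans (polarised (δ i) (δ j) (δ l)) (at-δ u i j l))

      -- Evaluation at `δ i + δ k` gives this mixed sum plus row products, and the latter cancel by
      -- `gram-row`.
      gram-symmetrised : ∀ i k j l →
        entries b i j ∙ entries b k l + entries b i l ∙ entries b k j
        ≈ entries u i j ∙ entries u k l + entries u i l ∙ entries u k j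
      gram-symmetrised i k j l = +-cancelˡ _ _ _
        (trans (sym (expand b i k j l)) (trans (polarised (λ t → δ i t + δ k t) (δ j) (δ l))
          (trans (expand u i k j l) (+-congʳ (sym (+-cong (gram-row i j l) (gram-row k j l)))))))

      -- For `l = j` the two terms of the symmetrised identity coincide.
      gram-column : ∀ i k j → entries b i j ∙ entries b k j ≈ entries u i j ∙ entries u k j
      gram-column i k j = double-cancel (gram-symmetrised i k j j)

-- The form of a graph as one square per edge.

module GraphForm (R : CommutativeRing 0ℓ 0ℓ) {m n} (G : AugmentedBipartiteGraph m n) where

  open CommutativeRing R hiding (zero; ring)
  open RingIdentities R
  open Bilinear R
  open AugmentedBipartiteGraph G

  χ : Cell m n → Matrix m n
  χ (i , j) k l = δ i k * δ j l

  χ-refl : ∀ c → χ c (proj₁ c) (proj₂ c) ≈ 1#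
  χ-refl (i , j) = trans (*-cong (δ-refl i) (δ-refl j)) (*-identityˡ 1#)

  χ-distinct : ∀ c i j → c ≢ (i , j) → χ c i j ≈ 0#
  χ-distinct (k , l) i j c≢ with k ≟ i
  ... | no _ = zeroˡ _
  ... | yes ≡.refl with l ≟ j
  ...   | no _       = zeroʳ _
  ...   | yes ≡.refl = contradiction ≡.refl c≢

  indicator : Edge m n → Matrix m n
  indicator (one c)     = χ c
  indicator (two e) k l = χ (half₁ e) k l + χ (half₂ e) k l

  -- The halves of a 2-edge are distinct, so their matrix units do not overlap and the entry is 1
  -- rather than 2.
  indicator-∈ : ∀ p {i j} → _∈ᵉ_ G (i , j) p → indicator (edge G p) i j ≈ 1#
  indicator-∈ (inj₁ k) (here ≡.refl) = χ-refl (lookup E₁ k)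
  indicator-∈ (inj₂ k) (here ≡.refl) = trans
    (+-cong (χ-refl (half₁ e)) (χ-distinct _ _ _ (distinct e ∘ ≡.sym))) (+-identityʳ 1#)
    where e = lookup E₂ k
  indicator-∈ (inj₂ k) (there (here ≡.refl)) = trans
    (+-cong (χ-distinct _ _ _ (distinct e)) (χ-refl (half₂ e))) (+-identityˡ 1#)
    where e = lookup E₂ k

  indicator-∉ : ∀ p {i j} → ¬ _∈ᵉ_ G (i , j) p → indicator (edge G p) i j ≈ 0#
  indicator-∉ (inj₁ _) c∉ = χ-distinct _ _ _ (c∉ ∘ here ∘ ≡.sym)
  indicator-∉ (inj₂ _) c∉ = trans
    (+-cong (χ-distinct _ _ _ (c∉ ∘ here ∘ ≡.sym)) (χ-distinct _ _ _ (c∉ ∘ there ∘ here ∘ ≡.sym)))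
    (+-identityˡ 0#)

  indexOf : Fin (length E₁ ℕ.+ length E₂) → Index G
  indexOf = splitAt (length E₁)

  indexOf-injective : ∀ {q q′} → indexOf q ≡ indexOf q′ → q ≡ q′
  indexOf-injective {q} {q′} eq = ≡.trans (≡.sym (join-splitAt (length E₁) (length E₂) q))
    (≡.trans (≡.cong (join (length E₁) (length E₂)) eq) (join-splitAt (length E₁) (length E₂) q′))

  standard : Fin (length E₁ ℕ.+ length E₂) → Matrix m n
  standard q = indicator (edge G (indexOf q))

  -- From here to `form`, the graph form is written over an arbitrary commutative ring; for ℝ it is
  -- compared with the original at the end.
  monomial : Vector Carrier m → Vector Carrier n → Cell m n → Carrier
  monomial x y c = x (proj₁ c) * y (proj₂ c)

  oneEdgeSquare : Vector Carrier m → Vector Carrier n → Cell m n → Carrier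
  oneEdgeSquare x y c = (x (proj₁ c) * x (proj₁ c)) * (y (proj₂ c) * y (proj₂ c))

  twoEdgeSquare : Vector Carrier m → Vector Carrier n → TwoEdge m n → Carrier
  twoEdgeSquare x y e =
    (monomial x y (half₁ e) + monomial x y (half₂ e)) *
    (monomial x y (half₁ e) + monomial x y (half₂ e))

  form : Vector Carrier m → Vector Carrier n → Carrier
  form x y =
    List.foldr _+_ 0# (List.map (oneEdgeSquare x y) E₁) +
    List.foldr _+_ 0# (List.map (twoEdgeSquare x y) E₂)

  foldr-map-lookup : ∀ {A : Set} (f : A → Carrier) xs →
    List.foldr _+_ 0# (List.map f xs) ≡ sum (f ∘ lookup xs)
  foldr-map-lookup f []       = ≡.refl
  foldr-map-lookup f (x ∷ xs) = ≡.cong (f x +_) (foldr-map-lookup f xs)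

  -- Yields the upper bound on the SOS rank: each edge contributes the square of the bilinear form
  -- of its indicator.
  form-standard : ∀ x y → form x y ≈ sumOfSquares standard x y
  form-standard x y = trans
    (+-cong
      (trans (reflexive (foldr-map-lookup (oneEdgeSquare x y) E₁))
        (sum-cong-≋ λ i → oneSquare (lookup E₁ i)))
      (trans (reflexive (foldr-map-lookup (twoEdgeSquare x y) E₂))
        (sum-cong-≋ λ j → twoSquare (lookup E₂ j))))
    (sym (sum-splitAt (length E₁) λ p → square (edge G p)))
    where
    square : Edge m n → Carrier
    square e = bilinear (indicator e) x y * bilinear (indicator e) x y
    oneSquare : ∀ c → oneEdgeSquare x y c ≈ square (one c)
    oneSquare (i , j) = trans (interchange (x i) (y j))
      (sym (*-cong (bilinear-δδ i j x y) (bilinear-δδ i j x y)))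
    twoSquare : ∀ e → twoEdgeSquare x y e ≈ square (two e)
    twoSquare e = sym (*-cong value value)
      where
      value : bilinear (indicator (two e)) x y ≈ monomial x y (half₁ e) + monomial x y (half₂ e)
      value = trans (bilinear-+ (χ (half₁ e)) (χ (half₂ e)) x y)
        (+-cong (bilinear-δδ _ _ x y) (bilinear-δδ _ _ x y))

  -- Recovering the Gram matrix on occupied cells from an arbitrary representation.

  module _ (real : IsFormallyReal R)
    (S : ConditionS G) (W1 : ConditionW1 G) (W2 : ConditionW2 G)
    (W2′ : ConditionW2′ G) (W3 : ConditionW3 G)
    {s} (b : Fin s → Matrix m n)
    (expansion : ∀ x y → form x y ≈ sumOfSquares b x y) where

    open import Relation.Binary.Reasoning.Setoid setoid

    open Ringₚ (CommutativeRing.ring R) using (+-cancelʳ)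

    private
      same : ∀ x y → sumOfSquares b x y ≈ sumOfSquares standard x y
      same x y = trans (sym (expansion x y)) (form-standard x y)

      infix 4 _∈ₑ_

      _∈ₑ_ : Cell m n → Index G → Set
      _∈ₑ_ = _∈ᵉ_ G

      v : Cell m n → Vector Carrier s
      v (i , j) = entries b i j

      u : Cell m n → Vector Carrier (length E₁ ℕ.+ length E₂)
      u (i , j) = entries standard i j

      Agree : Cell m n → Cell m n → Set
      Agree c d = v c ∙ v d ≈ u c ∙ u d

      agree-sym : ∀ {c d} → Agree c d → Agree d c
      agree-sym {c} {d} eq = trans (∙-comm (v d) (v c)) (trans eq (∙-comm (u c) (u d)))

      agree-row : ∀ {c d} → proj₁ c ≡ proj₁ d → Agree c d
      agree-row {i , j} {i , l} ≡.refl = gram-row real b standard same i j l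

      agree-column : ∀ {c d} → proj₂ c ≡ proj₂ d → Agree c d
      agree-column {i , j} {k , j} ≡.refl = gram-column real b standard same i k j

      -- The symmetrised identity fixes the sum over a pair of cells and its opposite pair, so
      -- agreement at one gives agreement at the other.
      agree-swap : ∀ {i j k l} → Agree (i , l) (k , j) → Agree (i , j) (k , l)
      agree-swap {i} {j} {k} {l} eq = +-cancelʳ _ _ _
        (trans (gram-symmetrised real b standard same i k j l) (+-congˡ (sym eq)))

      -- By (S) only the owner of `c` has a nonzero coefficient there, so `u c` is the basis vector
      -- at the position of `p`.
      u-owned : ∀ p {c} d → c ∈ₑ p → u c ∙ u d ≈ indicator (edge G p) (proj₁ d) (proj₂ d)
      u-owned p {c} d c∈p = begin
        u c ∙ u d
          ≈⟨ sum-single _ q₀ (λ q q≢ → trans (*-congʳ (elsewhere q q≢)) (zeroˡ _)) ⟩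
        u c q₀ * u d q₀
          ≈⟨ *-congʳ (trans (reflexive (at-q₀ c)) (indicator-∈ p c∈p)) ⟩
        1# * u d q₀
          ≈⟨ *-identityˡ _ ⟩
        u d q₀
          ≈⟨ reflexive (at-q₀ d) ⟩
        indicator (edge G p) (proj₁ d) (proj₂ d) ∎
        where
        q₀ : Fin _
        q₀ = join (length E₁) (length E₂) p
        at-q₀ : ∀ d → u d q₀ ≡ indicator (edge G p) (proj₁ d) (proj₂ d)
        at-q₀ d = ≡.cong (λ p → indicator (edge G p) (proj₁ d) (proj₂ d))
          (splitAt-join (length E₁) (length E₂) p)
        elsewhere : ∀ q → q ≢ q₀ → u c q ≈ 0#
        elsewhere q q≢ = indicator-∉ (indexOf q) λ c∈q →
          q≢ (indexOf-injective (≡.trans (owner-unique G S (indexOf q) p c∈q c∈p)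
            (≡.sym (splitAt-join (length E₁) (length E₂) p))))

      u-same : ∀ p {c d} → c ∈ₑ p → d ∈ₑ p → u c ∙ u d ≈ 1#
      u-same p {d = d} c∈p d∈p = trans (u-owned p d c∈p) (indicator-∈ p d∈p)

      u-other : ∀ p q {c d} → p ≢ q → c ∈ₑ p → d ∈ₑ q → u c ∙ u d ≈ 0#
      u-other p q {d = d} p≢q c∈p d∈q = trans (u-owned p d c∈p)
        (indicator-∉ p λ d∈p → p≢q (owner-unique G S p q d∈p d∈q))

      v-unit : ∀ p {c} → c ∈ₑ p → v c ∙ v c ≈ 1#
      v-unit p c∈p = trans (agree-row ≡.refl) (u-same p c∈p c∈p)

      -- The squared norm of `v c` equals that of `u c`, which is zero; by definiteness `v c` itself
      -- vanishes.
      agree-unoccupied : ∀ {c d} → Unoccupied G c → Agree c d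
      agree-unoccupied {c} {d} free = trans
        (∙-zeroˡ (v d) (∙-definite real (v c) (trans (agree-row ≡.refl) (∙-zeroˡ (u c) u-zero))))
        (sym (∙-zeroˡ (u d) u-zero))
        where
        u-zero : ∀ q → u c q ≈ 0#
        u-zero q = indicator-∉ (indexOf q) (free ∘ owned⇒occupied G (indexOf q))

      Constant : Index G → Set
      Constant p = ∀ {c d} → c ∈ₑ p → d ∈ₑ p → ∀ t → v c t ≈ v d t

      constant-agree : ∀ p → Constant p → ∀ {c d} → c ∈ₑ p → d ∈ₑ p → Agree c d
      constant-agree p const {c} {d} c∈ d∈ = begin
        v c ∙ v d  ≈⟨ ∙-cong (const c∈ d∈) (λ _ → refl) ⟩
        v d ∙ v d  ≈⟨ v-unit p d∈ ⟩
        1#         ≈⟨ u-same p c∈ d∈ ⟨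
        u c ∙ u d  ∎

      -- Between two constant edges the product of `v`-vectors does not depend on the cells chosen,
      -- and the product of `u`-vectors is always 0.
      agree-transport : ∀ p q → p ≢ q → Constant p → Constant q → ∀ {c c′ d d′} →
        c ∈ₑ p → c′ ∈ₑ p → d ∈ₑ q → d′ ∈ₑ q → Agree c d → Agree c′ d′
      agree-transport p q p≢q const-p const-q {c} {c′} {d} {d′} c∈ c′∈ d∈ d′∈ eq = begin
        v c′ ∙ v d′  ≈⟨ ∙-cong (const-p c′∈ c∈) (const-q d′∈ d∈) ⟩
        v c ∙ v d    ≈⟨ eq ⟩
        u c ∙ u d    ≈⟨ u-other p q p≢q c∈ d∈ ⟩
        0#           ≈⟨ u-other p q p≢q c′∈ d′∈ ⟨
        u c′ ∙ u d′  ∎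

      agree-across : ∀ p q → p ≢ q → Constant p → Constant q →
        IsTwoEdge (edge G p) ⊎ IsTwoEdge (edge G q) →
        ∀ {c d} → c ∈ₑ p → d ∈ₑ q → Agree c d
      agree-across p q p≢q const-p const-q two? c∈ d∈ with contact G W3 p q two?
      ... | sameRow a b    =
        agree-transport p q p≢q const-p const-q a c∈ b d∈ (agree-row ≡.refl)
      ... | sameColumn a b =
        agree-transport p q p≢q const-p const-q a c∈ b d∈ (agree-column ≡.refl)
      ... | gap₁ a b free  = agree-transport p q p≢q const-p const-q a c∈ b d∈
        (agree-swap (agree-unoccupied free))
      ... | gap₂ a b free  = agree-transport p q p≢q const-p const-q a c∈ b d∈
        (agree-swap (agree-sym (agree-unoccupied free)))

      constant-one : ∀ i → Constant (inj₁ i)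
      constant-one i (here ≡.refl) (here ≡.refl) t = refl

      constant-two : ∀ j →
        (∀ t → v (half₁ (lookup E₂ j)) t ≈ v (half₂ (lookup E₂ j)) t) → Constant (inj₂ j)
      constant-two j eq (here ≡.refl)         (here ≡.refl)         t = refl
      constant-two j eq (here ≡.refl)         (there (here ≡.refl)) t = eq t
      constant-two j eq (there (here ≡.refl)) (here ≡.refl)         t = sym (eq t)
      constant-two j eq (there (here ≡.refl)) (there (here ≡.refl)) t = refl

      constant-halves : ∀ j → Agree (half₁ (lookup E₂ j)) (half₂ (lookup E₂ j)) → Constant (inj₂ j)
      -- The equality case is applied with the two halves in both roles.
      constant-halves j eq = constant-two j (unit-vectors-agree real _ _ _ _
        (v-unit p (here ≡.refl)) (v-unit p (there (here ≡.refl)))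
        (v-unit p (here ≡.refl)) (v-unit p (there (here ≡.refl)))
        (+-cong inner-1 inner-1))
        where
        p = inj₂ j
        inner-1 = trans eq (u-same p (here ≡.refl) (there (here ≡.refl)))

      -- The halves of a degenerate 2-edge lie in one row or column, where the Gram matrices agree.
      constant-or-nondegenerate : ∀ j → Constant (inj₂ j) ⊎ Nondegenerate (lookup E₂ j)
      constant-or-nondegenerate j
        with proj₁ (half₁ (lookup E₂ j)) ≟ proj₁ (half₂ (lookup E₂ j))
           | proj₂ (half₁ (lookup E₂ j)) ≟ proj₂ (half₂ (lookup E₂ j))
      ... | yes i≡k | _       = inj₁ (constant-halves j (agree-row i≡k))
      ... | no _    | yes j≡l = inj₁ (constant-halves j (agree-column j≡l))
      ... | no i≢k  | no j≢l  = inj₂ (i≢k , j≢l)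

      -- The two inner products add up to `1# + 1#`, the maximum for two pairs of unit vectors, so
      -- the halves carry the same vector.
      constant-paired : ∀ j q →
        opposite₁ (lookup E₂ j) ∈ₑ q → opposite₂ (lookup E₂ j) ∈ₑ q → Constant (inj₂ j)
      constant-paired j q o₁ o₂ = constant-two j (unit-vectors-agree real _ _ _ _
        (v-unit p (here ≡.refl)) (v-unit p (there (here ≡.refl))) (v-unit q o₁) (v-unit q o₂)
        (trans (gram-symmetrised real b standard same _ _ _ _)
          (+-cong (u-same p (here ≡.refl) (there (here ≡.refl))) (u-same q o₁ o₂))))
        where p = inj₂ j

      -- A 2-edge with neither opposite cell unoccupied and without a
      -- complementary partner is treated after its successors in 𝓓.

      constant-step : ∀ j → (∀ j′ → UnpairedArc G j j′ → Constant (inj₂ j′)) → Constant (inj₂ j)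
      constant-step j ih with constant-or-nondegenerate j
      ... | inj₁ const = const
      ... | inj₂ nd with owner? G (opposite₁ (lookup E₂ j)) | owner? G (opposite₂ (lookup E₂ j))
      ...   | no free | _ =
        constant-halves j (agree-swap (agree-unoccupied (free ∘ occupied⇒owned G)))
      ...   | yes _   | no free =
        constant-halves j (agree-swap (agree-sym (agree-unoccupied (free ∘ occupied⇒owned G))))
      ...   | yes (q , o₁∈q) | yes (r , o₂∈r) with _≟ᵉ_ G q r
      -- A single owner of both opposite cells is a complementary partner.
      ...     | yes ≡.refl = constant-paired j q o₁∈q o₂∈r
      ...     | no q≢r = constant-halves j (agree-swap (agree-across q r q≢r
        (constant-next q (inj₁ ≡.refl)) (constant-next r (inj₂ ≡.refl)) two? o₁∈q o₂∈r))
        where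
        -- 1-edges and degenerate 2-edges are constant outright; only nondegenerate owners need the
        -- induction hypothesis.
        constant-next : ∀ p → p ≡ q ⊎ p ≡ r → Constant p
        constant-next (inj₁ i)  _ = constant-one i
        constant-next (inj₂ j′) p≡ with constant-or-nondegenerate j′
        ... | inj₁ const = const
        ... | inj₂ nd′   = ih j′ (unpairedArc G S j nd o₁∈q o₂∈r q≢r j′ nd′ p≡)
        -- (W3) requires a 2-edge among the owners; (W2') rules out that both opposite cells are
        -- 1-edges.
        two? : IsTwoEdge (edge G q) ⊎ IsTwoEdge (edge G r)
        two? with isTwoEdge-or-∈E₁ G q o₁∈q | isTwoEdge-or-∈E₁ G r o₂∈r
        ... | inj₁ two-q | _          = inj₁ two-q
        ... | inj₂ _     | inj₁ two-r = inj₂ two-r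
        ... | inj₂ o₁∈E₁ | inj₂ o₂∈E₁ =
          contradiction (o₁∈E₁ , o₂∈E₁) (W2′ (lookup E₂ j) (isEdge G (inj₂ j)) nd)

      constant : ∀ p → Constant p
      constant (inj₁ i) = constant-one i
      constant (inj₂ j) = acyclic-induction {P = Constant ∘ inj₂}
        (unpairedArc-acyclic G W2) constant-step j

      -- Constancy and (W3) settle everything except two different 1-edges, which are left for (W1).
      agree-same-or-two : ∀ p q {c d} → c ∈ₑ p → d ∈ₑ q → Agree c d ⊎ (c ∈ᶜ E₁ × d ∈ᶜ E₁)
      agree-same-or-two p q c∈ d∈ with _≟ᵉ_ G p q
      ... | yes ≡.refl = inj₁ (constant-agree p (constant p) c∈ d∈)
      ... | no p≢q with isTwoEdge-or-∈E₁ G p c∈ | isTwoEdge-or-∈E₁ G q d∈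
      ...   | inj₁ two-p | _          =
        inj₁ (agree-across p q p≢q (constant p) (constant q) (inj₁ two-p) c∈ d∈)
      ...   | inj₂ _     | inj₁ two-q =
        inj₁ (agree-across p q p≢q (constant p) (constant q) (inj₂ two-q) c∈ d∈)
      ...   | inj₂ c∈E₁  | inj₂ d∈E₁  = inj₂ (c∈E₁ , d∈E₁)

      -- For cells in different rows and columns, either agreement is already known at the opposite
      -- pair, or both opposite cells are 1-edges and complete a forbidden `C₄`.
      agree-E₁ : ∀ {c d} → c ∈ᶜ E₁ → d ∈ᶜ E₁ → Agree c d
      agree-E₁ {i , j} {k , l} c∈ d∈ with i ≟ k | j ≟ l
      ... | yes i≡k | _       = agree-row i≡k
      ... | no _    | yes j≡l = agree-column j≡l
      ... | no i≢k  | no j≢l with owner? G (i , l) | owner? G (k , j)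
      ...   | no free | _       = agree-swap (agree-unoccupied (free ∘ occupied⇒owned G))
      ...   | yes _   | no free =
        agree-swap (agree-sym (agree-unoccupied (free ∘ occupied⇒owned G)))
      ...   | yes (p , il∈p) | yes (q , kj∈q) with agree-same-or-two p q il∈p kj∈q
      ...     | inj₁ eq = agree-swap eq
      ...     | inj₂ (il∈ , kj∈) = contradiction (c∈ , il∈ , kj∈ , d∈) (W1 i k j l i≢k j≢l)

      agree-owned : ∀ p q {c d} → c ∈ₑ p → d ∈ₑ q → Agree c d
      agree-owned p q c∈ d∈ with agree-same-or-two p q c∈ d∈
      ... | inj₁ eq          = eq
      ... | inj₂ (c∈₁ , d∈₁) = agree-E₁ c∈₁ d∈₁

      representative : ∀ p → ∃ λ c → c ∈ₑ p
      representative (inj₁ i) = lookup E₁ i , here ≡.refl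
      representative (inj₂ j) = half₁ (lookup E₂ j) , here ≡.refl

    -- One coefficient vector is taken per edge. Their Gram matrix is that of the given squares, the
    -- identity.
    squares-≤ : length E₁ ℕ.+ length E₂ ℕ.≤ s
    squares-≤ = orthonormal⇒≤ real (λ a → v (proj₁ (rep a))) orthonormal
      where
      rep : ∀ a → ∃ λ c → c ∈ₑ indexOf a
      rep a = representative (indexOf a)
      orthonormal : ∀ a a′ → v (proj₁ (rep a)) ∙ v (proj₁ (rep a′)) ≈ δ a a′
      orthonormal a a′
        with a ≟ a′ | agree-owned (indexOf a) (indexOf a′) (proj₂ (rep a)) (proj₂ (rep a′))
      ... | yes ≡.refl | agree = trans agree (u-same (indexOf a) (proj₂ (rep a)) (proj₂ (rep a)))
      ... | no a≢a′    | agree = trans agree (u-other (indexOf a) (indexOf a′)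
        (a≢a′ ∘ indexOf-injective) (proj₂ (rep a)) (proj₂ (rep a′)))

-- The Cauchy reals are formally real.

open import Defs using
  ( ℝ; seq; 0ℝ; 1ℝ; _≈_; _+_; _*_; _²; ≈-refl; ≈-sym; ≈-trans; +-cong; *-cong
  ; ℝ-commutativeRing; sum; bilinear; graphForm; oneEdgeSquare; twoEdgeSquare)

private
  module ℝ-ring = CommutativeRing ℝ-commutativeRing
  module ℝ-Bilinear = Bilinear ℝ-commutativeRing

∣p-0∣≡∣p∣ : ∀ p → ∣ p ℚ.- 0ℚ ∣ ≡ ∣ p ∣
∣p-0∣≡∣p∣ p = ≡.cong ∣_∣ (ℚₚ.+-identityʳ p)

-- Order is used only through real numbers that have a representing sequence
-- of nonnegative rationals.

NonNegativeℝ : ℝ → Set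
NonNegativeℝ x = ∃ λ y → y ≈ x × (∀ n → 0ℚ ℚ.≤ seq y n)

p²-nonNeg : ∀ p → 0ℚ ℚ.≤ p ℚ.* p
p²-nonNeg p with ℚₚ.≤-total 0ℚ p
... | inj₁ 0≤p = ℚₚ.nonNegative⁻¹ (p ℚ.* p)
  {{ℚₚ.nonNeg*nonNeg⇒nonNeg p {{ℚ.nonNegative 0≤p}} p {{ℚ.nonNegative 0≤p}}}}
... | inj₂ p≤0 = ℚₚ.nonNegative⁻¹ (p ℚ.* p)
  {{ℚₚ.nonPos*nonPos⇒nonPos p {{ℚ.nonPositive p≤0}} p {{ℚ.nonPositive p≤0}}}}

-- For nonnegative representatives the first sequence is dominated termwise by the sum, which is a
-- null sequence.
ℝ-sum-zeroˡ : ∀ {x y} → NonNegativeℝ x → NonNegativeℝ y → x + y ≈ 0ℝ → x ≈ 0ℝ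
ℝ-sum-zeroˡ {x} {y} (x′ , x′≈x , x′≥) (y′ , y′≈y , y′≥) x+y≈0 =
  ≈-trans {x} {x′} {0ℝ} (≈-sym {x′} {x} x′≈x) λ ε 0<ε →
    let N , close = x′+y′≈0 ε 0<ε in
    N , λ n N≤n → ℚₚ.≤-<-trans
      (≡.subst₂ ℚ._≤_ (≡.sym (trim (x′≥ n))) (≡.sym (trim (sum≥ n)))
        (≡.subst (ℚ._≤ seq x′ n ℚ.+ seq y′ n) (ℚₚ.+-identityʳ (seq x′ n))
          (ℚₚ.+-monoʳ-≤ (seq x′ n) (y′≥ n))))
      (close n N≤n)
  where
  x′+y′≈0 : x′ + y′ ≈ 0ℝ
  x′+y′≈0 = ≈-trans {x′ + y′} {x + y} {0ℝ} (+-cong {x′} {x} {y′} {y} x′≈x y′≈y) x+y≈0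
  trim : ∀ {p} → 0ℚ ℚ.≤ p → ∣ p ℚ.- 0ℚ ∣ ≡ p
  trim {p} 0≤p = ≡.trans (∣p-0∣≡∣p∣ p) (ℚₚ.0≤p⇒∣p∣≡p 0≤p)
  sum≥ : ∀ n → 0ℚ ℚ.≤ seq x′ n ℚ.+ seq y′ n
  sum≥ n = ℚₚ.+-mono-≤ {0ℚ} {seq x′ n} {0ℚ} {seq y′ n} (x′≥ n) (y′≥ n)

ℝ-reduced : ∀ {x} → x * x ≈ 0ℝ → x ≈ 0ℝ
-- The bound `ε * ε` on squares is the right one: a term of absolute value at least `ε` would have a
-- square of at least `ε * ε`.
ℝ-reduced {x} x²≈0 ε 0<ε with x²≈0 (ε ℚ.* ε) 0<ε²
  where
  0<ε² : 0ℚ ℚ.< ε ℚ.* ε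
  0<ε² = ℚₚ.positive⁻¹ (ε ℚ.* ε) {{ℚₚ.pos*pos⇒pos ε {{ℚ.positive 0<ε}} ε {{ℚ.positive 0<ε}}}}
... | N , close = N , λ n N≤n → ≡.subst (ℚ._< ε) (≡.sym (∣p-0∣≡∣p∣ (seq x n)))
  (ℚₚ.≰⇒> λ ε≤ → ℚₚ.<-irrefl ≡.refl (ℚₚ.<-≤-trans (close n N≤n) (≡.subst (ε ℚ.* ε ℚ.≤_)
    (≡.trans (≡.sym (ℚₚ.∣p*q∣≡∣p∣*∣q∣ (seq x n) (seq x n)))
      (≡.sym (∣p-0∣≡∣p∣ (seq x n ℚ.* seq x n))))
    (ℚₚ.≤-trans (ℚₚ.*-monoʳ-≤-nonNeg ε {{ℚₚ.pos⇒nonNeg ε {{ℚ.positive 0<ε}}}} ε≤)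
      (ℚₚ.*-monoˡ-≤-nonNeg ∣ seq x n ∣ {{ℚₚ.∣-∣-nonNeg (seq x n)}} ε≤)))))

ℝ-1≉0 : ¬ 1ℝ ≈ 0ℝ
ℝ-1≉0 1≈0 with 1≈0 1ℚ (ℚₚ.positive⁻¹ 1ℚ)
... | N , close = ℚₚ.<-irrefl ≡.refl (close N ℕₚ.≤-refl)

ℝ-isFormallyReal : IsFormallyReal ℝ-commutativeRing
ℝ-isFormallyReal = record
  { NonNegative = NonNegativeℝ
  ; nonNeg-resp = λ { {x} {y} x≈y (z , z≈x , z≥) → z , ≈-trans {z} {x} {y} z≈x x≈y , z≥ }
  ; +-nonNeg    = λ { {x} {y} (x′ , x′≈x , x′≥) (y′ , y′≈y , y′≥) →
      x′ + y′ , +-cong {x′} {x} {y′} {y} x′≈x y′≈y ,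
      λ n → ℚₚ.+-mono-≤ {0ℚ} {seq x′ n} {0ℚ} {seq y′ n} (x′≥ n) (y′≥ n) }
  ; ²-nonNeg    = λ x → x * x , ≈-refl {x * x} , λ n → p²-nonNeg (seq x n)
  ; sum-zeroˡ   = λ {x} {y} → ℝ-sum-zeroˡ {x} {y}
  ; reduced     = λ {x} → ℝ-reduced {x}
  ; 1≉0         = ℝ-1≉0
  }

-- Transfer from the abstract ring to ℝ.

-- Definitional comparison of two reals with stuck operations compares their
-- Cauchy proofs as well, which is infeasible; _≈_ only looks at the sequences.

sum-bridge : ∀ {n} (f g : Fin n → ℝ) → (∀ i → f i ≈ g i) → sum f ≈ ℝ-Bilinear.sum g
sum-bridge {zero}  f g eq = ≈-refl {0ℝ}
sum-bridge {suc n} f g eq = +-cong {f zero} {g zero} {sum (f ∘ suc)} {ℝ-Bilinear.sum (g ∘ suc)}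
  (eq zero) (sum-bridge (f ∘ suc) (g ∘ suc) (eq ∘ suc))

foldr-bridge : ∀ {A : Set} (f g : A → ℝ) xs → (∀ a → f a ≈ g a) →
  List.foldr _+_ 0ℝ (List.map f xs) ≈ List.foldr ℝ-ring._+_ ℝ-ring.0# (List.map g xs)
foldr-bridge f g []       eq = ≈-refl {0ℝ}
foldr-bridge f g (x ∷ xs) eq = +-cong {f x} {g x}
  {List.foldr _+_ 0ℝ (List.map f xs)} {List.foldr ℝ-ring._+_ ℝ-ring.0# (List.map g xs)}
  (eq x) (foldr-bridge f g xs eq)

bilinear-bridge : ∀ {m n} (b : Fin m → Fin n → ℝ) x y → bilinear b x y ≈ ℝ-Bilinear.bilinear b x y
bilinear-bridge b x y = sum-bridge
  (λ i → sum λ j → b i j * x i * y j)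
  (λ i → ℝ-Bilinear.sum λ j → ℝ-ring._*_ (ℝ-ring._*_ (b i j) (x i)) (y j)) λ i →
  sum-bridge (λ j → b i j * x i * y j) (λ j → ℝ-ring._*_ (ℝ-ring._*_ (b i j) (x i)) (y j)) λ j →
    ≈-refl {b i j * x i * y j}

squares-bridge : ∀ {m n r} (b : Fin r → Fin m → Fin n → ℝ) x y →
  (sum λ p → bilinear (b p) x y ²) ≈ Bilinear.sumOfSquares ℝ-commutativeRing b x y
squares-bridge b x y = sum-bridge
  (λ p → bilinear (b p) x y ²)
  _
  λ p ε →
    *-cong {bilinear (b p) x y} {ℝ-Bilinear.bilinear (b p) x y}
      {bilinear (b p) x y} {ℝ-Bilinear.bilinear (b p) x y}
      (bilinear-bridge (b p) x y) (bilinear-bridge (b p) x y) ε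

form-bridge : ∀ {m n} (G : AugmentedBipartiteGraph m n) x y →
  graphForm G x y ≈ GraphForm.form ℝ-commutativeRing G x y
form-bridge G x y = +-cong
  {List.foldr _+_ 0ℝ (List.map (oneEdgeSquare x y) E₁)}
  {List.foldr ℝ-ring._+_ ℝ-ring.0# (List.map (F.oneEdgeSquare x y) E₁)}
  {List.foldr _+_ 0ℝ (List.map (twoEdgeSquare x y) E₂)}
  {List.foldr ℝ-ring._+_ ℝ-ring.0# (List.map (F.twoEdgeSquare x y) E₂)}
  (foldr-bridge (oneEdgeSquare x y) (F.oneEdgeSquare x y) E₁ λ c → ≈-refl {oneEdgeSquare x y c})
  (foldr-bridge (twoEdgeSquare x y) (F.twoEdgeSquare x y) E₂ λ e → ≈-refl {twoEdgeSquare x y e})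
  where
  open AugmentedBipartiteGraph G
  module F = GraphForm ℝ-commutativeRing G

theorem7 : (m n : ℕ) → n ≤ m → 2 ≤ n →
    (G : AugmentedBipartiteGraph m n) →
    ConditionS G → ConditionW1 G → ConditionW2 G → ConditionW2′ G → ConditionW3 G →
    Irreducible G
theorem7 m n _ _ G S W1 W2 W2′ W3 =
  -- Upper bound: the given squares, one per edge.
  ( GraphForm.standard ℝ-commutativeRing G
  , λ x y → ≈-trans {graphForm G x y} {GraphForm.form ℝ-commutativeRing G x y}
      {sum λ p → bilinear (GraphForm.standard ℝ-commutativeRing G p) x y ²}
      (form-bridge G x y)
      (≈-trans {GraphForm.form ℝ-commutativeRing G x y}
        {Bilinear.sumOfSquares ℝ-commutativeRing (GraphForm.standard ℝ-commutativeRing G) x y}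
        {sum λ p → bilinear (GraphForm.standard ℝ-commutativeRing G p) x y ²}
        (GraphForm.form-standard ℝ-commutativeRing G x y)
        (≈-sym {sum λ p → bilinear (GraphForm.standard ℝ-commutativeRing G p) x y ²}
          {Bilinear.sumOfSquares ℝ-commutativeRing (GraphForm.standard ℝ-commutativeRing G) x y}
          (squares-bridge (GraphForm.standard ℝ-commutativeRing G) x y))) )
  -- Lower bound: the bridges turn a representation by `s` squares into one of the abstract `form`.
  , λ s (b , eq) → GraphForm.squares-≤ ℝ-commutativeRing G ℝ-isFormallyReal S W1 W2 W2′ W3 b λ x y →
      ≈-trans {GraphForm.form ℝ-commutativeRing G x y} {graphForm G x y}
        {Bilinear.sumOfSquares ℝ-commutativeRing b x y}
        (≈-sym {graphForm G x y} {GraphForm.form ℝ-commutativeRing G x y} (form-bridge G x y))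
        (≈-trans {graphForm G x y} {sum λ p → bilinear (b p) x y ²}
          {Bilinear.sumOfSquares ℝ-commutativeRing b x y}
          (eq x y) (squares-bridge b x y))
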